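{- (1) For every integer $n\ge 33$, \[\max N(0,3;n)=\begin{cases}7^{n/7} & n\equiv 0 \pmod 7\\ 37^2\cdot 16\cdot 7^{(n-36)/7} & n\equiv 1\pmod 7\\ 37\cdot 16\cdot 7^{(n-23)/7} & n\equiv 2\pmod 7\\ 16\cdot 7^{(n-10)/7} & n\equiv 3\pmod 7\\ 37^3\cdot 7^{(n-39)/7} & n\equiv 4\pmod 7\\ 37^2\cdot 7^{(n-26)/7} & n\equiv 5\pmod 7\\ 37\cdot 7^{(n-13)/7} & n\equiv 6\pmod 7,\end{cases}\] and this maximum is attained at a unique partition of $n$, namely: all parts equal to $7$ when $n\equiv 0$; parts $13,13,10$ followed by parts $7$ when $n\equiv1$; parts $13,10$ followed by parts $7$ when $n\equiv 2$; part $10$ followed by parts $7$ when $n\equiv 3$; parts $13,13,13$ followed by parts $7$ when $n\equiv 4$; parts $13,13$ followed by parts $7$ when $n\equiv 5$; part $13$ followed by parts $7$ when $n\equiv 6 \pmod 7$ (in each case with as many parts $7$ as needed to reach $n$, possibly none). (2) For every integer $n\ge 22$, $\max N(1,3;n)=\max N(2,3;n)$ and \[\max N(1,3;n)=\begin{cases}46^{n/14} & n\equiv 0\pmod{14}\\ 59\cdot 46^{(n-15)/14} & n\equiv 1\\ 59^2\cdot 46^{(n-30)/14} & n\equiv 2\\ 101\cdot 46^{(n-17)/14} & n\equiv 3\\ 101\cdot 59\cdot 46^{(n-32)/14} & n\equiv 4\\ 20^3\cdot 46^{(n-33)/14} & n\equiv 5\\ 26\cdot 20^2\cdot 46^{(n-34)/14}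 & n\equiv 6\\ 26^2\cdot 20\cdot 46^{(n-35)/14} & n\equiv 7\\ 20^2\cdot 46^{(n-22)/14} & n\equiv 8\\ 26\cdot 20\cdot 46^{(n-23)/14} & n\equiv 9\\ 26^2\cdot 46^{(n-24)/14} & n\equiv 10\\ 20\cdot 46^{(n-11)/14} & n\equiv 11\\ 26\cdot 46^{(n-12)/14} & n\equiv 12\\ 59\cdot 26\cdot 46^{(n-27)/14} & n\equiv 13 \pmod{14},\end{cases}\] and for both $r=1$ and $r=2$ this maximum is attained at a unique partition of $n$, namely the partition consisting of the following parts together with as many parts $14$ as needed to reach $n$ (possibly none): no other parts when $n\equiv 0$; $15$ when $n\equiv 1$; $15,15$ when $n\equiv 2$; $17$ when $n\equiv 3$; $17,15$ when $n\equiv 4$; $11,11,11$ when $n\equiv 5$; $12,11,11$ when $n\equiv 6$; $12,12,11$ when $n\equiv 7$; $11,11$ when $n\equiv 8$; $12,11$ when $n\equiv 9$; $12,12$ when $n\equiv 10$; $11$ when $n\equiv 11$; $12$ when $n\equiv 12$; $15,12$ when $n\equiv 13\pmod{14}$.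
   Context: A partition of $n$ is a finite nonincreasing sequence of positive integers $\lambda=(\lambda_1,\dots,\lambda_k)$ summing to $n$; $P(n)$ is the set of partitions of $n$. The rank of $\lambda$ is $\lambda_1-k$. For integers $r$ and $t\ge1$, $N(r,t;n)$ is the number of partitions of $n$ with rank $\equiv r\pmod t$. This is extended multiplicatively to partitions by $N(r,3;\lambda):=\prod_{j=1}^k N(r,3;\lambda_j)$, and $\max N(r,3;n):=\max\{N(r,3;\lambda):\lambda\in P(n)\}$. -}

module Defs where

open import Data.Nat using (_⊓_; ℕ; zero; suc; _+_; _*_; _∸_; _^_; _≤_; _<_; _⊔_; _≟_; NonZero)
open import Data.Nat.DivMod using (_/_; _%_)
open import Data.Integer as ℤ using (ℤ; +_)
open import Data.Integer.DivMod using (_%ℕ_)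
open import Data.List using (List; []; _∷_; map; concatMap; applyUpTo; length; filter; foldr; replicate; _++_)
open import Data.Nat.ListAction using (sum; product)
open import Data.List.Relation.Unary.All using (All)
open import Data.List.Relation.Unary.Linked using (Linked)
open import Relation.Binary.PropositionalEquality using (_≡_)
open import Relation.Nullary using (Dec)

record IsPartition (n : ℕ) (λs : List ℕ) : Set where
  field
    nonincreasing : Linked (λ a b → b ≤ a) λs
    positive      : All (λ a → 1 ≤ a) λs
    sums          : sum λs ≡ n

-- Enumeration of the partitions of n (the finite set P(n)).
-- partsFuel f n m : partitions of n with every part ≤ m (fuel f ≥ n suffices,
-- since each step removes a part ≥ 1).
partsFuel : ℕ → ℕ → ℕ → List (List ℕ)
partsFuel _ zero _ = [] ∷ []
partsFuel zero (suc n) _ = []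
partsFuel (suc f) (suc n) m =
  concatMap (λ k → map (k ∷_) (partsFuel f (suc n ∸ k) k))
            (applyUpTo suc (m ⊓ suc n))

partitions : ℕ → List (List ℕ)
partitions n = partsFuel n n n

largest : List ℕ → ℕ
largest [] = 0
largest (x ∷ _) = x

rank : List ℕ → ℤ
rank λs = (+ largest λs) ℤ.- (+ length λs)

N : ℤ → (t : ℕ) → .{{NonZero t}} → ℕ → ℕ
N r t n = length (filter (λ λs → (rank λs %ℕ t) ≟ (r %ℕ t)) (partitions n))

N3 : ℤ → List ℕ → ℕ
N3 r λs = product (map (N r 3) λs)

maxN3 : ℤ → ℕ → ℕ
maxN3 r n = foldr _⊔_ 0 (map (N3 r) (partitions n))

value0 : ℕ → ℕ
value0 n with n % 7
... | 0 = 7 ^ (n / 7)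
... | 1 = 37 ^ 2 * 16 * 7 ^ ((n ∸ 36) / 7)
... | 2 = 37 * 16 * 7 ^ ((n ∸ 23) / 7)
... | 3 = 16 * 7 ^ ((n ∸ 10) / 7)
... | 4 = 37 ^ 3 * 7 ^ ((n ∸ 39) / 7)
... | 5 = 37 ^ 2 * 7 ^ ((n ∸ 26) / 7)
... | _ = 37 * 7 ^ ((n ∸ 13) / 7)

prefix0 : ℕ → List ℕ
prefix0 n with n % 7
... | 0 = []
... | 1 = 13 ∷ 13 ∷ 10 ∷ []
... | 2 = 13 ∷ 10 ∷ []
... | 3 = 10 ∷ []
... | 4 = 13 ∷ 13 ∷ 13 ∷ []
... | 5 = 13 ∷ 13 ∷ []
... | _ = 13 ∷ []

maximiser0 : ℕ → List ℕ
maximiser0 n = prefix0 n ++ replicate ((n ∸ sum (prefix0 n)) / 7) 7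

value12 : ℕ → ℕ
value12 n with n % 14
... | 0  = 46 ^ (n / 14)
... | 1  = 59 * 46 ^ ((n ∸ 15) / 14)
... | 2  = 59 ^ 2 * 46 ^ ((n ∸ 30) / 14)
... | 3  = 101 * 46 ^ ((n ∸ 17) / 14)
... | 4  = 101 * 59 * 46 ^ ((n ∸ 32) / 14)
... | 5  = 20 ^ 3 * 46 ^ ((n ∸ 33) / 14)
... | 6  = 26 * 20 ^ 2 * 46 ^ ((n ∸ 34) / 14)
... | 7  = 26 ^ 2 * 20 * 46 ^ ((n ∸ 35) / 14)
... | 8  = 20 ^ 2 * 46 ^ ((n ∸ 22) / 14)
... | 9  = 26 * 20 * 46 ^ ((n ∸ 23) / 14)
... | 10 = 26 ^ 2 * 46 ^ ((n ∸ 24) / 14)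
... | 11 = 20 * 46 ^ ((n ∸ 11) / 14)
... | 12 = 26 * 46 ^ ((n ∸ 12) / 14)
... | _  = 59 * 26 * 46 ^ ((n ∸ 27) / 14)

prefix12 : ℕ → List ℕ
prefix12 n with n % 14
... | 0  = []
... | 1  = 15 ∷ []
... | 2  = 15 ∷ 15 ∷ []
... | 3  = 17 ∷ []
... | 4  = 17 ∷ 15 ∷ []
... | 5  = 11 ∷ 11 ∷ 11 ∷ []
... | 6  = 12 ∷ 11 ∷ 11 ∷ []
... | 7  = 12 ∷ 12 ∷ 11 ∷ []
... | 8  = 11 ∷ 11 ∷ []
... | 9  = 12 ∷ 11 ∷ []
... | 10 = 12 ∷ 12 ∷ []
... | 11 = 11 ∷ []
... | 12 = 12 ∷ []
... | _  = 15 ∷ 12 ∷ []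

-- The maximiser written in nonincreasing order: parts 17/15 precede the 14s,
-- parts 12/11 follow them.
maximiser12 : ℕ → List ℕ
maximiser12 n with n % 14
... | 1  = 15 ∷ replicate ((n ∸ 15) / 14) 14
... | 2  = 15 ∷ 15 ∷ replicate ((n ∸ 30) / 14) 14
... | 3  = 17 ∷ replicate ((n ∸ 17) / 14) 14
... | 4  = 17 ∷ 15 ∷ replicate ((n ∸ 32) / 14) 14
... | 13 = 15 ∷ (replicate ((n ∸ 27) / 14) 14 ++ 12 ∷ [])
... | _  = replicate ((n ∸ sum (prefix12 n)) / 14) 14 ++ prefix12 n

{-# OPTIONS --safe #-}

-- Fix a residue r and put f k = N(r, 3; k). A quasi-periodic envelope W, with W (n + 7) = 7 W n
-- (resp. W (n + 14) = 46 W n), which agrees for large n with the claimed maximum times W 0,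
-- satisfies f k * W n ≤ W (k + n) for all k and n, strictly unless k is one of the parts 7, 10, 13
-- (resp. 11, 12, 14, 15, 17). Induction over a partition μ of n gives f μ * W 0 ≤ W n, and equality
-- forces every part to be one of these; exchanging a few parts for others of the same sum and larger
-- product, such as 10, 10 for 13, 7, then leaves exactly one partition.
-- By quasi-periodicity the inequality is a finite check for each k. For k < 75 the values of f come
-- from a recursive table; for k ≥ 75 it suffices that f k ≤ p(k) ≤ 6756 (7/6)^k, which follows from
-- comparing p(k) (6/7)^k with the product of the 1 / (1 - (6/7)^i).

module Submission where

open import Defs
open import Data.Nat using (ℕ; _≤_)
open import Data.Integer using (+_)
open import Data.List using (List)
open import Data.Product using (_×_)
open import Function.Bundles using (_⇔_)
open import Relation.Binary.PropositionalEquality using (_≡_)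

open import Data.Nat
open import Data.Nat.DivMod
open import Data.Nat.Divisibility using (n∣m*n)
open import Data.Nat.ListAction using (sum; product)
open import Data.Nat.ListAction.Properties using (sum-++; product-++)
open import Data.Nat.Properties
open import Data.Nat.Tactic.RingSolver using (solve-∀)
import Data.Integer as ℤ
import Data.Integer.Properties as ℤ
open import Data.Integer.DivMod using (_%ℕ_)
open import Data.Empty using (⊥-elim)
open import Data.List using ([]; _∷_; map; concatMap; upTo; applyDownFrom; length; filter; foldr; replicate; _++_; _∷ʳ_)
open import Data.List.Properties using (map-id; map-++; map-∘; map-cong; map-upTo; upTo-∷ʳ; concatMap-cong; concatMap-map; concatMap-++; ++-identityʳ; length-++; length-map; length-filter; length-applyDownFrom)
open import Data.List.Membership.DecPropositional _≟_ using (_∈?_)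
open import Data.List.Membership.Propositional using (_∈_; _∉_)
open import Data.List.Membership.Propositional.Properties using (∈-concatMap⁺; ∈-applyUpTo⁺; ∈-map⁺)
open import Data.List.Relation.Unary.All as All using (All; []; _∷_)
import Data.List.Relation.Unary.All.Properties as All
open import Data.List.Relation.Unary.AllPairs using (AllPairs; []; _∷_; allPairs?)
import Data.List.Relation.Unary.AllPairs.Properties as AllPairs
open import Data.List.Relation.Unary.Any as Any using (here; there)
open import Data.List.Relation.Unary.Linked as Linked using (Linked; [-]; _∷_)
open import Data.List.Relation.Unary.Linked.Properties using (AllPairs⇒Linked; Linked⇒AllPairs)
open import Data.Product as Product using (_,_; proj₁; proj₂; ∃)
open import Data.Sum using (_⊎_; inj₁; inj₂)
open import Data.Unit using (⊤; tt)
open import Data.Vec using (Vec; []; _∷_; zipWith)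
open import Function using (_∘_; id)
open import Function.Bundles using (mk⇔)
open import Relation.Binary.PropositionalEquality
open import Relation.Nullary using (yes; no; ¬_; Dec)
open import Relation.Nullary.Decidable using (toWitness; True; _×-dec_; _⊎-dec_)

-- The closed formulas cannot serve as the induction hypothesis: for small n their exponents are
-- negative, and W n / W 0 is then only a strict upper bound. Scaling by W 0 keeps W integral for
-- every n, so the induction over the parts may pass through all small sums. The ratio 7/6 has to
-- exceed 1, since p(k) grows subexponentially, and to stay below the growth rates 7^(1/7) and
-- 46^(1/14), both about 1.3. Nearer to 1 the infinite product explodes; nearer to the growth rates
-- less is gained per unit of k. The constant 6756 is the product up to i = 30, times 1 + 7
-- (6/7)^30, rounded up. Below the cutoff the obstacle is size: 74 has more than seven million
-- partitions, too many to list. Removing the largest part leaves a partition whose rank is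
-- irrelevant and whose length alone matters, so a table of lengths modulo 3 determines the ranks
-- modulo 3.

-- Partitions with bounded parts

boundedPartitions : ℕ → ℕ → List (List ℕ)
boundedPartitions n m = partsFuel n n m

partsFuel-suc : ∀ f n m → partsFuel (suc f) (suc n) m ≡
  concatMap (λ i → map (suc i ∷_) (partsFuel f (n ∸ i) (suc i))) (upTo (m ⊓ suc n))
partsFuel-suc f n m = trans
  (cong (concatMap g) (sym (map-upTo suc (m ⊓ suc n))))
  (concatMap-map g suc (upTo (m ⊓ suc n)))
  where
  g : ℕ → List (List ℕ)
  g k = map (k ∷_) (partsFuel f (suc n ∸ k) k)

partsFuel-irrelevant : ∀ {f g} n m → n ≤ f → n ≤ g → partsFuel f n m ≡ partsFuel g n m
partsFuel-irrelevant zero m _ _ = refl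
partsFuel-irrelevant {suc f} {suc g} (suc n) m (s≤s n≤f) (s≤s n≤g) = begin
  partsFuel (suc f) (suc n) m ≡⟨ partsFuel-suc f n m ⟩
  concatMap (λ i → map (suc i ∷_) (partsFuel f (n ∸ i) (suc i))) (upTo (m ⊓ suc n))
    ≡⟨ concatMap-cong (λ i → cong (map (suc i ∷_))
         (partsFuel-irrelevant (n ∸ i) (suc i) (≤-trans (m∸n≤m n i) n≤f) (≤-trans (m∸n≤m n i) n≤g)))
         (upTo (m ⊓ suc n)) ⟩
  concatMap (λ i → map (suc i ∷_) (partsFuel g (n ∸ i) (suc i))) (upTo (m ⊓ suc n))
    ≡⟨ partsFuel-suc g n m ⟨
  partsFuel (suc g) (suc n) m ∎
  where open ≡-Reasoning

boundedPartitions-≥ : ∀ {n m} → n ≤ m → boundedPartitions n (suc m) ≡ boundedPartitions n m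
boundedPartitions-≥ {zero}  _ = refl
boundedPartitions-≥ {suc n} {m} n≤m
  rewrite m≥n⇒m⊓n≡n n≤m | m≥n⇒m⊓n≡n (<⇒≤ n≤m) = refl

-- The enumeration lets the largest part increase, so the partitions with largest part exactly
-- `suc m` form its last block. Writing the sum as `suc m + n` avoids a truncated subtraction.
boundedPartitions-+ : ∀ m n → boundedPartitions (suc m + n) (suc m) ≡
  boundedPartitions (suc m + n) m ++ map (suc m ∷_) (boundedPartitions n (suc m))
boundedPartitions-+ m n = begin
  partsFuel (suc (m + n)) (suc (m + n)) (suc m)
    ≡⟨ partsFuel-suc (m + n) (m + n) (suc m) ⟩
  concatMap g (upTo (suc (m ⊓ (m + n))))
    ≡⟨ cong (concatMap g ∘ upTo ∘ suc) (m≤n⇒m⊓n≡m (m≤m+n m n)) ⟩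
  concatMap g (upTo (suc m))
    ≡⟨ cong (concatMap g) (upTo-∷ʳ m) ⟨
  concatMap g (upTo m ∷ʳ m)
    ≡⟨ concatMap-++ g (upTo m) (m ∷ []) ⟩
  concatMap g (upTo m) ++ (g m ++ [])
    ≡⟨ cong₂ _++_ smaller-parts (trans (++-identityʳ (g m)) largest-part) ⟩
  boundedPartitions (suc m + n) m ++ map (suc m ∷_) (boundedPartitions n (suc m)) ∎
  where
  open ≡-Reasoning
  g : ℕ → List (List ℕ)
  g i = map (suc i ∷_) (partsFuel (m + n) (m + n ∸ i) (suc i))
  smaller-parts : concatMap g (upTo m) ≡ boundedPartitions (suc m + n) m
  smaller-parts = trans (cong (concatMap g ∘ upTo) (sym (m≤n⇒m⊓n≡m (m≤n⇒m≤1+n (m≤m+n m n)))))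
                (sym (partsFuel-suc (m + n) (m + n) m))
  largest-part : g m ≡ map (suc m ∷_) (boundedPartitions n (suc m))
  largest-part rewrite m+n∸m≡n m n =
    cong (map (suc m ∷_)) (partsFuel-irrelevant n (suc m) (m≤n+m n m) ≤-refl)

length-boundedPartitions-+ : ∀ m n → length (boundedPartitions (suc m + n) (suc m)) ≡
  length (boundedPartitions (suc m + n) m) + length (boundedPartitions n (suc m))
length-boundedPartitions-+ m n = begin
  length (boundedPartitions (suc m + n) (suc m))
    ≡⟨ cong length (boundedPartitions-+ m n) ⟩
  length (boundedPartitions (suc m + n) m ++ map (suc m ∷_) (boundedPartitions n (suc m)))
    ≡⟨ length-++ (boundedPartitions (suc m + n) m) ⟩
  length (boundedPartitions (suc m + n) m) + length (map (suc m ∷_) (boundedPartitions n (suc m)))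
    ≡⟨ cong (λ l → length (boundedPartitions (suc m + n) m) + l) (length-map (suc m ∷_) (boundedPartitions n (suc m))) ⟩
  length (boundedPartitions (suc m + n) m) + length (boundedPartitions n (suc m)) ∎
  where open ≡-Reasoning

partitions-bounded : ∀ {n m} → n ≤ m → boundedPartitions n m ≡ partitions n
partitions-bounded n≤m = stable (≤⇒≤′ n≤m)
  where
  stable : ∀ {n m} → n ≤′ m → boundedPartitions n m ≡ partitions n
  stable ≤′-refl = refl
  stable (≤′-step n≤′m) = trans (boundedPartitions-≥ (≤′⇒≤ n≤′m)) (stable n≤′m)

-- An exponential bound for the number of partitions

-- F m / E m is the product of 1 / (1 - (6/7)^i) over 1 ≤ i ≤ m, the value at 6/7 of the generating
-- function of the partitions into parts at most m.
E F : ℕ → ℕ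
E zero    = 1
E (suc m) = (7 ^ suc m ∸ 6 ^ suc m) * E m
F zero    = 1
F (suc m) = 7 ^ suc m * F m

6^≤7^ : ∀ m → 6 ^ m ≤ 7 ^ m
6^≤7^ m = ^-monoˡ-≤ m (toWitness {a? = 6 ≤? 7} tt)

-- A coefficient of the generating function times its power of q = 6/7 is at most the value P m = F
-- m / E m at q. Without power series: splitting by whether the part m + 1 occurs, the two summands
-- are at most P m and q^(m+1) P (m+1), and these add up to P (m+1). The inner induction removes a
-- part m + 1 from n, which is why `bounded` carries fuel.
count-bound : ∀ m n → E m * length (boundedPartitions n m) * 6 ^ n ≤ F m * 7 ^ n
count-bound zero    zero    = ≤-refl
count-bound zero    (suc n) = z≤n
count-bound (suc m) n       = bounded n n ≤-refl
  where
  open ≤-Reasoning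
  expand : ∀ d e a b s x → d * e * (a + b) * (s * x) ≡ d * (e * a * (s * x)) + s * (d * e * b * x)
  expand = solve-∀
  collect : ∀ d F t y s → d * (F * (t * y)) + s * (t * F * y) ≡ (d + s) * F * (t * y)
  collect = solve-∀
  combine : ∀ t s e c a b x y → s ≤ t → e * a * (s * x) ≤ c * (t * y) →
    (t ∸ s) * e * b * x ≤ t * c * y → (t ∸ s) * e * (a + b) * (s * x) ≤ t * c * (t * y)
  combine t s e c a b x y s≤t h₁ h₂ = begin
    d * e * (a + b) * (s * x)                   ≡⟨ expand d e a b s x ⟩
    d * (e * a * (s * x)) + s * (d * e * b * x) ≤⟨ +-mono-≤ (*-monoʳ-≤ d h₁) (*-monoʳ-≤ s h₂) ⟩
    d * (c * (t * y)) + s * (t * c * y)         ≡⟨ collect d c t y s ⟩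
    (d + s) * c * (t * y)                       ≡⟨ cong (λ z → z * c * (t * y)) (m∸n+n≡m s≤t) ⟩
    t * c * (t * y)                             ∎
    where d = t ∸ s
  bounded : ∀ f n → n ≤ f →
    E (suc m) * length (boundedPartitions n (suc m)) * 6 ^ n ≤ F (suc m) * 7 ^ n
  bounded f n n≤f with suc m ≤? n
  ... | no  m≰n rewrite boundedPartitions-≥ {n} {m} (s≤s⁻¹ (≰⇒> m≰n)) = begin
    (7 ^ suc m ∸ 6 ^ suc m) * E m * c * 6 ^ n
      ≤⟨ *-monoˡ-≤ (6 ^ n) (*-monoˡ-≤ c (*-monoˡ-≤ (E m) (m∸n≤m (7 ^ suc m) (6 ^ suc m)))) ⟩
    7 ^ suc m * E m * c * 6 ^ n
      ≡⟨ assoc (7 ^ suc m) (E m) c (6 ^ n) ⟩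
    7 ^ suc m * (E m * c * 6 ^ n)
      ≤⟨ *-monoʳ-≤ (7 ^ suc m) (count-bound m n) ⟩
    7 ^ suc m * (F m * 7 ^ n)
      ≡⟨ *-assoc (7 ^ suc m) (F m) (7 ^ n) ⟨
    7 ^ suc m * F m * 7 ^ n ∎
    where
    c = length (boundedPartitions n m)
    assoc : ∀ a b c d → a * b * c * d ≡ a * (b * c * d)
    assoc = solve-∀
  bounded zero n n≤f | yes m≤n = ⊥-elim (n≮0 (≤-trans m≤n n≤f))
  bounded (suc f) n n≤f | yes m≤n with m≤n⇒∃[o]m+o≡n m≤n
  ... | k , refl = begin
    d * E m * length (boundedPartitions (suc m + k) (suc m)) * 6 ^ (suc m + k)
      ≡⟨ cong₂ (λ l x → d * E m * l * x) (length-boundedPartitions-+ m k) (^-distribˡ-+-* 6 (suc m) k) ⟩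
    d * E m * (a + b) * (6 ^ suc m * 6 ^ k)
      ≤⟨ combine (7 ^ suc m) (6 ^ suc m) (E m) (F m) a b (6 ^ k) (7 ^ k) (6^≤7^ (suc m))
           smaller (bounded f k (s≤s⁻¹ (≤-trans (s≤s (m≤n+m k m)) n≤f))) ⟩
    7 ^ suc m * F m * (7 ^ suc m * 7 ^ k)
      ≡⟨ cong (7 ^ suc m * F m *_) (^-distribˡ-+-* 7 (suc m) k) ⟨
    7 ^ suc m * F m * 7 ^ (suc m + k) ∎
    where
    d = 7 ^ suc m ∸ 6 ^ suc m
    a = length (boundedPartitions (suc m + k) m)
    b = length (boundedPartitions k (suc m))
    smaller : E m * a * (6 ^ suc m * 6 ^ k) ≤ F m * (7 ^ suc m * 7 ^ k)
    smaller = subst₂ (λ x y → E m * a * x ≤ F m * y)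
      (^-distribˡ-+-* 6 (suc m) k) (^-distribˡ-+-* 7 (suc m) k)
      (count-bound m (suc m + k))

-- The extra factor 1 + 7 (6/7)^m makes the bound on F m / E m inductive.
product-tail : ∀ {m} → 30 ≤′ m → F m * (7 ^ m + 7 * 6 ^ m) ≤ E m * 7 ^ m * 6756
product-tail ≤′-refl = toWitness {a? = F 30 * (7 ^ 30 + 7 * 6 ^ 30) ≤? E 30 * 7 ^ 30 * 6756} tt
product-tail (≤′-step {m} 30≤m) =
  increment (7 ^ m) (6 ^ m) (E m) (F m) 6756 (6^*42≤7^ 30≤m) (product-tail 30≤m)
  where
  open ≤-Reasoning
  -- Origin of 42: with x = (6/7)^m, the inductive step is 1 + 6x ≤ (1 + 7x)(1 - 6x/7), which for x
  -- > 0 means x ≤ 1/42.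
  6^*42≤7^ : ∀ {m} → 30 ≤′ m → 6 ^ m * 42 ≤ 7 ^ m
  6^*42≤7^ ≤′-refl = toWitness {a? = 6 ^ 30 * 42 ≤? 7 ^ 30} tt
  6^*42≤7^ (≤′-step {m} 30≤m) = begin
    6 * 6 ^ m * 42   ≡⟨ *-assoc 6 (6 ^ m) 42 ⟩
    6 * (6 ^ m * 42) ≤⟨ *-mono-≤ (n≤1+n 6) (6^*42≤7^ 30≤m) ⟩
    7 * 7 ^ m        ∎
  -- Substituting a = 42 b + e turns the inequality of `factor` into a subtraction-free identity
  -- with surplus 7 b e.
  polynomial : ∀ b e → 7 * (b * 42 + e) * (7 * (b * 42 + e) + 7 * (6 * b)) + 7 * (b * e) ≡
                       7 * ((b * 42 + e) + 7 * b) * (7 * e + b * 288)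
  polynomial = solve-∀
  difference : ∀ b e → 7 * (b * 42 + e) ≡ 7 * e + b * 288 + 6 * b
  difference = solve-∀
  factor : ∀ a b → b * 42 ≤ a →
    7 * a * (7 * a + 7 * (6 * b)) ≤ 7 * (a + 7 * b) * (7 * a ∸ 6 * b)
  factor a b b≤a with m≤n⇒∃[o]m+o≡n b≤a
  ... | e , refl = begin
    7 * a * (7 * a + 7 * (6 * b))             ≤⟨ m≤m+n _ (7 * (b * e)) ⟩
    7 * a * (7 * a + 7 * (6 * b)) + 7 * (b * e) ≡⟨ polynomial b e ⟩
    7 * (a + 7 * b) * (7 * e + b * 288)         ≡⟨ cong (7 * (a + 7 * b) *_) (m+n∸n≡m _ (6 * b)) ⟨
    7 * (a + 7 * b) * (7 * e + b * 288 + 6 * b ∸ 6 * b)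
      ≡⟨ cong (λ x → 7 * (a + 7 * b) * (x ∸ 6 * b)) (difference b e) ⟨
    7 * (a + 7 * b) * (7 * a ∸ 6 * b)           ∎
  rearrange : ∀ a f b → 7 * a * f * (7 * a + 7 * (6 * b)) ≡ f * (7 * a * (7 * a + 7 * (6 * b)))
  rearrange = solve-∀
  rearrange′ : ∀ f x d → f * (7 * x * d) ≡ 7 * d * (f * x)
  rearrange′ = solve-∀
  rearrange″ : ∀ d e x c → 7 * d * (e * x * c) ≡ d * e * (7 * x) * c
  rearrange″ = solve-∀
  increment : ∀ a b e f c → b * 42 ≤ a → f * (a + 7 * b) ≤ e * a * c →
    7 * a * f * (7 * a + 7 * (6 * b)) ≤ (7 * a ∸ 6 * b) * e * (7 * a) * c
  increment a b e f c b≤a h = begin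
    7 * a * f * (7 * a + 7 * (6 * b))   ≡⟨ rearrange a f b ⟩
    f * (7 * a * (7 * a + 7 * (6 * b))) ≤⟨ *-monoʳ-≤ f (factor a b b≤a) ⟩
    f * (7 * (a + 7 * b) * d)           ≡⟨ rearrange′ f (a + 7 * b) d ⟩
    7 * d * (f * (a + 7 * b))           ≤⟨ *-monoʳ-≤ (7 * d) h ⟩
    7 * d * (e * a * c)                 ≡⟨ rearrange″ d e a c ⟩
    d * e * (7 * a) * c                 ∎
    where d = 7 * a ∸ 6 * b

E-nonZero : ∀ m → NonZero (E m)
E-nonZero zero    = _
E-nonZero (suc m) = m*n≢0 _ _
  {{>-nonZero (m<n⇒0<n∸m (^-monoˡ-< (suc m) (toWitness {a? = 6 <? 7} tt)))}} {{E-nonZero m}}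

partitions-bound : ∀ {m} → 30 ≤ m → length (partitions m) * 6 ^ m ≤ 7 ^ m * 6756
partitions-bound {m} 30≤m = *-cancelˡ-≤ (E m) {{E-nonZero m}} (begin
  E m * (length (partitions m) * 6 ^ m) ≡⟨ *-assoc (E m) _ _ ⟨
  E m * length (partitions m) * 6 ^ m   ≤⟨ count-bound m m ⟩
  F m * 7 ^ m                           ≤⟨ *-monoʳ-≤ (F m) (m≤m+n (7 ^ m) (7 * 6 ^ m)) ⟩
  F m * (7 ^ m + 7 * 6 ^ m)             ≤⟨ product-tail (≤⇒≤′ 30≤m) ⟩
  E m * 7 ^ m * 6756                    ≡⟨ *-assoc (E m) (7 ^ m) 6756 ⟩
  E m * (7 ^ m * 6756)                  ∎)
  where open ≤-Reasoning

-- Counting by residues modulo 3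

ℕ³ : Set
ℕ³ = ℕ × ℕ × ℕ

infixl 6 _⊕_
_⊕_ : ℕ³ → ℕ³ → ℕ³
(a , b , c) ⊕ (a′ , b′ , c′) = a + a′ , b + b′ , c + c′

𝟎 : ℕ³
𝟎 = 0 , 0 , 0

-- The effect on the three class sizes of adding 1 to every number counted.
rotate : ℕ³ → ℕ³
rotate (a , b , c) = c , a , b

rotates : ℕ → ℕ³ → ℕ³
rotates zero    t = t
rotates (suc k) t = rotate (rotates k t)

unit : ℕ → ℕ³
unit 0 = 1 , 0 , 0
unit 1 = 0 , 1 , 0
unit _ = 0 , 0 , 1

residues : List ℕ → ℕ³
residues []       = 𝟎
residues (x ∷ xs) = unit (x % 3) ⊕ residues xs

⊕-assoc : ∀ s t u → (s ⊕ t) ⊕ u ≡ s ⊕ (t ⊕ u)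
⊕-assoc (a , b , c) (a′ , b′ , c′) (a″ , b″ , c″) =
  cong₂ _,_ (+-assoc a a′ a″) (cong₂ _,_ (+-assoc b b′ b″) (+-assoc c c′ c″))

⊕-identityʳ : ∀ t → t ⊕ 𝟎 ≡ t
⊕-identityʳ (a , b , c) = cong₂ _,_ (+-identityʳ a) (cong₂ _,_ (+-identityʳ b) (+-identityʳ c))

residues-++ : ∀ xs ys → residues (xs ++ ys) ≡ residues xs ⊕ residues ys
residues-++ []       ys = refl
residues-++ (x ∷ xs) ys =
  trans (cong (unit (x % 3) ⊕_) (residues-++ xs ys)) (sym (⊕-assoc (unit (x % 3)) (residues xs) (residues ys)))

unit-suc : ∀ n → unit (suc n % 3) ≡ rotate (unit (n % 3))
unit-suc 0 = refl
unit-suc 1 = refl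
unit-suc 2 = refl
unit-suc (suc (suc (suc n))) = unit-suc n

residues-shift : ∀ k xs → residues (map (_+_ k) xs) ≡ rotates k (residues xs)
residues-shift zero    xs = cong residues (map-id xs)
residues-shift (suc k) xs = begin
  residues (map (suc ∘ (_+_ k)) xs)       ≡⟨ cong residues (map-∘ xs) ⟩
  residues (map suc (map (_+_ k) xs))     ≡⟨ residues-suc (map (_+_ k) xs) ⟩
  rotate (residues (map (_+_ k) xs))      ≡⟨ cong rotate (residues-shift k xs) ⟩
  rotate (rotates k (residues xs))       ∎
  where
  open ≡-Reasoning
  residues-suc : ∀ xs → residues (map suc xs) ≡ rotate (residues xs)
  residues-suc []       = refl
  residues-suc (x ∷ xs) = cong₂ _⊕_ (unit-suc x) (residues-suc xs)

rotates-𝟎 : ∀ k → rotates k 𝟎 ≡ 𝟎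
rotates-𝟎 zero    = refl
rotates-𝟎 (suc k) = cong rotate (rotates-𝟎 k)

-- Ranks and lengths modulo 3

-- Twice the length: modulo 3 this is minus the length.
doubleLength : List ℕ → ℕ
doubleLength []       = 0
doubleLength (_ ∷ μ)  = 2 + doubleLength μ

rankCode : List ℕ → ℕ
rankCode μ = largest μ + doubleLength μ

-- As 2 ≡ -1 modulo 3, the integer remainder becomes one of a natural number. A unit of a cancels
-- against a part; once a is zero, parts are dropped three at a time, which changes neither
-- remainder.
⊖-%3 : ∀ a μ → (a ℤ.⊖ length μ) %ℕ 3 ≡ (a + doubleLength μ) % 3
⊖-%3 zero    []              = refl
⊖-%3 zero    (_ ∷ [])        = refl
⊖-%3 zero    (_ ∷ _ ∷ [])    = refl
⊖-%3 zero    (_ ∷ _ ∷ _ ∷ μ) = trans (peel μ) (⊖-%3 zero μ)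
  where
  peel : ∀ μ → (0 ℤ.⊖ (3 + length μ)) %ℕ 3 ≡ (0 ℤ.⊖ length μ) %ℕ 3
  peel []      = refl
  peel (_ ∷ μ) = refl
⊖-%3 (suc a) []      = cong (_% 3) (sym (+-identityʳ (suc a)))
⊖-%3 (suc a) (x ∷ μ) = begin
  (suc a ℤ.⊖ suc (length μ)) %ℕ 3 ≡⟨ cong (_%ℕ 3) (ℤ.[1+m]⊖[1+n]≡m⊖n a (length μ)) ⟩
  (a ℤ.⊖ length μ) %ℕ 3           ≡⟨ ⊖-%3 a μ ⟩
  (a + doubleLength μ) % 3        ≡⟨⟩
  (3 + (a + doubleLength μ)) % 3  ≡⟨ cong (λ n → suc n % 3) (trans (+-suc a (suc (doubleLength μ))) (cong suc (+-suc a (doubleLength μ)))) ⟨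
  (suc a + doubleLength (x ∷ μ)) % 3 ∎
  where open ≡-Reasoning

rank-%3 : ∀ μ → rank μ %ℕ 3 ≡ rankCode μ % 3
rank-%3 μ = trans (cong (_%ℕ 3) (ℤ.m-n≡m⊖n (largest μ) (length μ))) (⊖-%3 (largest μ) μ)

residueCount : ℕ → List (List ℕ) → ℕ
residueCount r μs = length (filter (λ μ → (rank μ %ℕ 3) ≟ r) μs)

residueCounts : ∀ μs → (residueCount 0 μs , residueCount 1 μs , residueCount 2 μs) ≡ residues (map rankCode μs)
residueCounts []       = refl
residueCounts (μ ∷ μs) rewrite rank-%3 μ | sym (residueCounts μs)
  with rankCode μ % 3 | m%n<n (rankCode μ) 3
... | 0 | _ = refl
... | 1 | _ = refl
... | 2 | _ = refl
... | suc (suc (suc _)) | s≤s (s≤s (s≤s ()))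

lengthCounts rankCounts : ℕ → ℕ → ℕ³
lengthCounts m n = residues (map doubleLength (boundedPartitions n m))
rankCounts   m n = residues (map rankCode (boundedPartitions n m))

N-rankCounts : ∀ {n m} → n ≤ m → (N (+ 0) 3 n , N (+ 1) 3 n , N (+ 2) 3 n) ≡ rankCounts m n
N-rankCounts {n} n≤m = trans (residueCounts (partitions n))
  (cong (residues ∘ map rankCode) (sym (partitions-bounded n≤m)))

-- One recursion for both statistics: prepending the part m + 1 shifts `doubleLength` by 2, and
-- gives a `rankCode` equal to m + 3 plus the `doubleLength` of the rest. In either case the second
-- summand involves lengths only.
residues-boundedPartitions-+ : ∀ (h : List ℕ → ℕ) k m n →
  (∀ μ → h (suc m ∷ μ) ≡ k + doubleLength μ) →
  residues (map h (boundedPartitions (suc m + n) (suc m))) ≡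
  residues (map h (boundedPartitions (suc m + n) m)) ⊕ rotates k (lengthCounts (suc m) n)
residues-boundedPartitions-+ h k m n h-cons = begin
  residues (map h (boundedPartitions (suc m + n) (suc m)))
    ≡⟨ cong (residues ∘ map h) (boundedPartitions-+ m n) ⟩
  residues (map h (xs ++ map (suc m ∷_) ys))
    ≡⟨ cong residues (map-++ h xs (map (suc m ∷_) ys)) ⟩
  residues (map h xs ++ map h (map (suc m ∷_) ys))
    ≡⟨ residues-++ (map h xs) (map h (map (suc m ∷_) ys)) ⟩
  residues (map h xs) ⊕ residues (map h (map (suc m ∷_) ys))
    ≡⟨ cong (λ zs → residues (map h xs) ⊕ residues zs) codes ⟩
  residues (map h xs) ⊕ residues (map (_+_ k) (map doubleLength ys))
    ≡⟨ cong (residues (map h xs) ⊕_) (residues-shift k (map doubleLength ys)) ⟩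
  residues (map h xs) ⊕ rotates k (lengthCounts (suc m) n) ∎
  where
  open ≡-Reasoning
  xs = boundedPartitions (suc m + n) m
  ys = boundedPartitions n (suc m)
  codes : map h (map (suc m ∷_) ys) ≡ map (_+_ k) (map doubleLength ys)
  codes = trans (sym (map-∘ ys)) (trans (map-cong h-cons ys) (map-∘ ys))

-- The table of rank counts

-- The default `𝟎` is meaningful: reading past the end corresponds to a negative sum, which has no
-- partitions.
at : List ℕ³ → ℕ → ℕ³
at []       _       = 𝟎
at (t ∷ _)  zero    = t
at (_ ∷ ts) (suc i) = at ts i

at-applyDownFrom-+ : ∀ g m n → at (applyDownFrom g (suc m + n)) m ≡ g n
at-applyDownFrom-+ g zero    n = refl
at-applyDownFrom-+ g (suc m) n = at-applyDownFrom-+ g m n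

at-applyDownFrom-≥ : ∀ g {m n} → n ≤ m → at (applyDownFrom g n) m ≡ 𝟎
at-applyDownFrom-≥ g {m}     {zero}  _         = refl
at-applyDownFrom-≥ g {suc m} {suc n} (s≤s n≤m) = at-applyDownFrom-≥ g n≤m

-- The recursion in the form used by the table, including the case n ≤ m, where the part m + 1
-- cannot occur and `at` returns its default.
counts-suc : ∀ (h : List ℕ → ℕ) k m n → (∀ μ → h (suc m ∷ μ) ≡ k + doubleLength μ) →
  residues (map h (boundedPartitions n m)) ⊕ rotates k (at (applyDownFrom (lengthCounts (suc m)) n) m) ≡
  residues (map h (boundedPartitions n (suc m)))
counts-suc h k m n h-cons with suc m ≤? n
... | no m≰n rewrite at-applyDownFrom-≥ (lengthCounts (suc m)) (s≤s⁻¹ (≰⇒> m≰n)) = begin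
  residues (map h (boundedPartitions n m)) ⊕ rotates k 𝟎
    ≡⟨ cong (residues (map h (boundedPartitions n m)) ⊕_) (rotates-𝟎 k) ⟩
  residues (map h (boundedPartitions n m)) ⊕ 𝟎
    ≡⟨ ⊕-identityʳ _ ⟩
  residues (map h (boundedPartitions n m))
    ≡⟨ cong (residues ∘ map h) (boundedPartitions-≥ (s≤s⁻¹ (≰⇒> m≰n))) ⟨
  residues (map h (boundedPartitions n (suc m))) ∎
  where open ≡-Reasoning
... | yes m<n with m≤n⇒∃[o]m+o≡n m<n
...   | o , refl = trans
  (cong (λ t → residues (map h (boundedPartitions (suc m + o) m)) ⊕ rotates k t)
    (at-applyDownFrom-+ (lengthCounts (suc m)) m o))
  (sym (residues-boundedPartitions-+ h k m o h-cons))

-- Rows are stored in descending order of n, so that entry m of the tail of row m + 1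
-- belongs to the index n - (m + 1).
lengthRow : ℕ → List ℕ³ → List ℕ³
lengthRow m []       = []
lengthRow m (t ∷ ts) = extend (lengthRow m ts)
  where
  -- The recursive result is used twice; taking it as an argument shares its evaluation, which would
  -- otherwise double at every entry. `pair` and `next` in `rows` do the same.
  extend : List ℕ³ → List ℕ³
  extend row = (t ⊕ rotates 2 (at row m)) ∷ row

rankRow : ℕ → List ℕ³ → List ℕ³ → List ℕ³
rankRow m (t ∷ ts) (_ ∷ row) = (t ⊕ rotates (suc m + 2) (at row m)) ∷ rankRow m ts row
rankRow m _        _         = []

rows : ℕ → ℕ → List ℕ³ × List ℕ³
rows L zero    = initial , initial
  where
  start : ℕ → ℕ³
  start zero    = unit 0
  start (suc _) = 𝟎
  initial = applyDownFrom start L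
rows L (suc m) = next (rows L m)
  where
  pair : List ℕ³ → List ℕ³ → List ℕ³ × List ℕ³
  pair ranks lengths = lengths , rankRow m ranks lengths
  next : List ℕ³ × List ℕ³ → List ℕ³ × List ℕ³
  next (lengths , ranks) = pair ranks (lengthRow m lengths)

lengthRow-correct : ∀ m L → lengthRow m (applyDownFrom (lengthCounts m) L) ≡ applyDownFrom (lengthCounts (suc m)) L
lengthRow-correct m zero    = refl
lengthRow-correct m (suc L) rewrite lengthRow-correct m L =
  cong (_∷ applyDownFrom (lengthCounts (suc m)) L) (counts-suc doubleLength 2 m L (λ _ → refl))

rankRow-correct : ∀ m L →
  rankRow m (applyDownFrom (rankCounts m) L) (applyDownFrom (lengthCounts (suc m)) L) ≡
  applyDownFrom (rankCounts (suc m)) L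
rankRow-correct m zero    = refl
rankRow-correct m (suc L) = cong₂ _∷_
  (counts-suc rankCode (suc m + 2) m L (λ μ → sym (+-assoc (suc m) 2 (doubleLength μ))))
  (rankRow-correct m L)

rows-correct : ∀ L m → rows L m ≡ (applyDownFrom (lengthCounts m) L , applyDownFrom (rankCounts m) L)
rows-correct L zero = initial L
  where
  initial : ∀ L → rows L zero ≡ (applyDownFrom (lengthCounts zero) L , applyDownFrom (rankCounts zero) L)
  initial zero          = refl
  initial (suc zero)    = refl
  initial (suc (suc L)) = cong (λ (xs , ys) → 𝟎 ∷ xs , 𝟎 ∷ ys) (initial (suc L))
rows-correct L (suc m)
  rewrite rows-correct L m | lengthRow-correct m L | rankRow-correct m L = refl

-- Quasi-periodic envelopes

^-distribʳ-* : ∀ a b j → (a * b) ^ j ≡ a ^ j * b ^ j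
^-distribʳ-* a b zero    = refl
^-distribʳ-* a b (suc j) = trans (cong (a * b *_) (^-distribʳ-* a b j)) ([m*n]*[o*p]≡[m*o]*[n*p] a b (a ^ j) (b ^ j))

module Envelope (T B : ℕ) .{{_ : NonZero T}} .{{_ : NonZero B}} (c : ℕ → ℕ) where

  W : ℕ → ℕ
  W n = c (n % T) * B ^ (n / T)

  W-shift : ∀ n j → W (n + j * T) ≡ W n * B ^ j
  W-shift n j = begin
    c ((n + j * T) % T) * B ^ ((n + j * T) / T)
      ≡⟨ cong₂ (λ r q → c r * B ^ q) ([m+kn]%n≡m%n n j T)
           (trans (+-distrib-/-∣ʳ n (n∣m*n j)) (cong (_+_ (n / T)) (m*n/n≡m j T))) ⟩
    c (n % T) * B ^ (n / T + j)
      ≡⟨ cong (c (n % T) *_) (^-distribˡ-+-* B (n / T) j) ⟩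
    c (n % T) * (B ^ (n / T) * B ^ j)
      ≡⟨ *-assoc (c (n % T)) _ _ ⟨
    W n * B ^ j ∎
    where open ≡-Reasoning

  W-scale : ∀ w t j → w * W 0 ≡ W t → w * B ^ j * W 0 ≡ W (t + j * T)
  W-scale w t j eq = begin
    w * B ^ j * W 0 ≡⟨ rearrange w (B ^ j) (W 0) ⟩
    w * W 0 * B ^ j ≡⟨ cong (_* B ^ j) eq ⟩
    W t * B ^ j     ≡⟨ W-shift t j ⟨
    W (t + j * T)   ∎
    where
    open ≡-Reasoning
    rearrange : ∀ x y z → x * y * z ≡ x * z * y
    rearrange = solve-∀

  W-residue : ∀ n → W n ≡ W (n % T) * B ^ (n / T)
  W-residue n = trans (cong W (m≡m%n+[m/n]*n n T)) (W-shift (n % T) (n / T))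

  W-+-residue : ∀ k n → W (k + n) ≡ W (k + n % T) * B ^ (n / T)
  W-+-residue k n = begin
    W (k + n)                         ≡⟨ cong (λ m → W (k + m)) (m≡m%n+[m/n]*n n T) ⟩
    W (k + (n % T + n / T * T))       ≡⟨ cong W (+-assoc k (n % T) _) ⟨
    W (k + n % T + n / T * T)         ≡⟨ W-shift (k + n % T) (n / T) ⟩
    W (k + n % T) * B ^ (n / T)       ∎
    where open ≡-Reasoning

  periodic-≤ : ∀ x k → (∀ {n} → n < T → x * W n ≤ W (k + n)) → ∀ n → x * W n ≤ W (k + n)
  periodic-≤ x k h n = begin
    x * W n                       ≡⟨ cong (x *_) (W-residue n) ⟩
    x * (W (n % T) * B ^ (n / T)) ≡⟨ *-assoc x _ _ ⟨
    x * W (n % T) * B ^ (n / T)   ≤⟨ *-monoˡ-≤ _ (h (m%n<n n T)) ⟩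
    W (k + n % T) * B ^ (n / T)   ≡⟨ W-+-residue k n ⟨
    W (k + n)                     ∎
    where open ≤-Reasoning

  periodic-< : ∀ x k → (∀ {n} → n < T → x * W n < W (k + n)) → ∀ n → x * W n < W (k + n)
  periodic-< x k h n = begin-strict
    x * W n                       ≡⟨ cong (x *_) (W-residue n) ⟩
    x * (W (n % T) * B ^ (n / T)) ≡⟨ *-assoc x _ _ ⟨
    x * W (n % T) * B ^ (n / T)   <⟨ *-monoˡ-< _ {{m^n≢0 B (n / T)}} (h (m%n<n n T)) ⟩
    W (k + n % T) * B ^ (n / T)   ≡⟨ W-+-residue k n ⟨
    W (k + n)                     ∎
    where open ≤-Reasoning

  -- Equality is tolerated only in the first alternative. It admits 0 besides `vs`, because N(0, 3;
  -- 0) = 1 gives equality at k = 0; this is harmless, as parts are positive.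
  StepAt : List ℕ → ℕ → ℕ → Set
  StepAt vs k x = (k ∈ 0 ∷ vs × (∀ {n} → n < T → x * W n ≤ W (k + n)))
                ⊎ (∀ {n} → n < T → x * W n < W (k + n))

  stepAt? : ∀ vs k x → Dec (StepAt vs k x)
  stepAt? vs k x = ((k ∈? 0 ∷ vs) ×-dec allUpTo? (λ n → x * W n ≤? W (k + n)) T)
               ⊎-dec allUpTo? (λ n → x * W n <? W (k + n)) T

  stepAt-≤ : ∀ {vs k x} → StepAt vs k x → ∀ n → x * W n ≤ W (k + n)
  stepAt-≤ {_} {k} {x} (inj₁ (_ , h))   = periodic-≤ x k h
  stepAt-≤ {_} {k} {x} (inj₂ h)       n = <⇒≤ (periodic-< x k h n)

  stepAt-< : ∀ {vs k x} → 1 ≤ k → k ∉ vs → StepAt vs k x → ∀ n → x * W n < W (k + n)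
  stepAt-< 1≤k k∉vs (inj₁ (here refl  , _)) = ⊥-elim (n≮0 1≤k)
  stepAt-< 1≤k k∉vs (inj₁ (there k∈vs , _)) = ⊥-elim (k∉vs k∈vs)
  stepAt-< {_} {k} {x} _ _ (inj₂ h)         = periodic-< x k h

  module Large (a b C K : ℕ) .{{_ : NonZero a}} (a^T≤b^T*B : a ^ T ≤ b ^ T * B)
    (base : ∀ {i} → i < T → ∀ {n} → n < T → a ^ (K + i) * C * W n < b ^ (K + i) * W (K + i + n)) where

    -- Moving k down by j periods into the window from K to K + T - 1, covered by `base`, divides
    -- the left side by (a^T)^j and the right side by the no smaller (b^T B)^j.
    geometric : ∀ {k n} → K ≤ k → n < T → a ^ k * C * W n < b ^ k * W (k + n)
    geometric {k} {n} K≤k n<T = subst (λ k → a ^ k * C * W n < b ^ k * W (k + n)) (sym k≡) (begin-strict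
      a ^ (l + j * T) * C * W n
        ≡⟨ cong (λ x → x * C * W n) (power a) ⟩
      a ^ l * (a ^ T) ^ j * C * W n
        ≡⟨ rearrange (a ^ l) ((a ^ T) ^ j) C (W n) ⟩
      a ^ l * C * W n * (a ^ T) ^ j
        <⟨ *-monoˡ-< _ {{m^n≢0 (a ^ T) j {{m^n≢0 a T}}}} (base (m%n<n (k ∸ K) T) n<T) ⟩
      b ^ l * W (l + n) * (a ^ T) ^ j
        ≤⟨ *-monoʳ-≤ (b ^ l * W (l + n)) (^-monoˡ-≤ j a^T≤b^T*B) ⟩
      b ^ l * W (l + n) * (b ^ T * B) ^ j
        ≡⟨ cong (b ^ l * W (l + n) *_) (^-distribʳ-* (b ^ T) B j) ⟩
      b ^ l * W (l + n) * ((b ^ T) ^ j * B ^ j)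
        ≡⟨ rearrange′ (b ^ l) (W (l + n)) ((b ^ T) ^ j) (B ^ j) ⟩
      b ^ l * (b ^ T) ^ j * (W (l + n) * B ^ j)
        ≡⟨ cong₂ _*_ (power b) (trans (cong W (xy∙z≈xz∙y l (j * T) n)) (W-shift (l + n) j)) ⟨
      b ^ (l + j * T) * W (l + j * T + n) ∎)
      where
      open ≤-Reasoning
      l = K + (k ∸ K) % T
      j = (k ∸ K) / T
      k≡ : k ≡ l + j * T
      k≡ = trans (sym (m+[n∸m]≡n K≤k))
        (trans (cong (_+_ K) (m≡m%n+[m/n]*n (k ∸ K) T)) (sym (+-assoc K _ _)))
      power : ∀ x → x ^ (l + j * T) ≡ x ^ l * (x ^ T) ^ j
      power x = trans (^-distribˡ-+-* x l (j * T))
        (cong (x ^ l *_) (trans (cong (x ^_) (*-comm j T)) (sym (^-*-assoc x T j))))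
      rearrange : ∀ p q c w → p * q * c * w ≡ p * c * w * q
      rearrange = solve-∀
      rearrange′ : ∀ p w q r → p * w * (q * r) ≡ p * q * (w * r)
      rearrange′ = solve-∀
      xy∙z≈xz∙y : ∀ x y z → x + y + z ≡ x + z + y
      xy∙z≈xz∙y = solve-∀

    dominated : ∀ {k x} → K ≤ k → x * b ^ k ≤ a ^ k * C → ∀ n → x * W n < W (k + n)
    dominated {k} {x} K≤k h = periodic-< x k (λ {n} n<T → *-cancelˡ-< (b ^ k) _ _ (begin-strict
      b ^ k * (x * W n) ≡⟨ rearrange (b ^ k) x (W n) ⟩
      x * b ^ k * W n   ≤⟨ *-monoˡ-≤ (W n) h ⟩
      a ^ k * C * W n   <⟨ geometric K≤k n<T ⟩
      b ^ k * W (k + n) ∎))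
      where
      open ≤-Reasoning
      rearrange : ∀ p x w → p * (x * w) ≡ x * p * w
      rearrange = solve-∀

    module Steps (vs : List ℕ) (f : ℕ → ℕ) (small : ∀ {k} → k < K → StepAt vs k (f k))
      (large : ∀ {k} → K ≤ k → f k * b ^ k ≤ a ^ k * C) where

      step : ∀ k n → f k * W n ≤ W (k + n)
      step k n with k <? K
      ... | yes k<K = stepAt-≤ {x = f k} (small k<K) n
      ... | no  k≮K = <⇒≤ (dominated {x = f k} (≮⇒≥ k≮K) (large (≮⇒≥ k≮K)) n)

      strict : ∀ {k} → 1 ≤ k → k ∉ vs → ∀ n → f k * W n < W (k + n)
      strict {k} 1≤k k∉vs n with k <? K
      ... | yes k<K = stepAt-< {x = f k} 1≤k k∉vs (small k<K) n
      ... | no  k≮K = dominated {x = f k} (≮⇒≥ k≮K) (large (≮⇒≥ k≮K)) n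

-- The two envelopes and their finite check

-- The envelopes are the claimed maxima for large n, scaled by 7 ^ 6 and 46 ^ 3.
residueConstant₀ residueConstant₁ : ℕ → ℕ
residueConstant₀ 0 = 7 ^ 6
residueConstant₀ 1 = 37 ^ 2 * 16 * 7
residueConstant₀ 2 = 37 * 16 * 7 ^ 3
residueConstant₀ 3 = 16 * 7 ^ 5
residueConstant₀ 4 = 37 ^ 3 * 7
residueConstant₀ 5 = 37 ^ 2 * 7 ^ 3
residueConstant₀ _ = 37 * 7 ^ 5
residueConstant₁ 0  = 46 ^ 3
residueConstant₁ 1  = 59 * 46 ^ 2
residueConstant₁ 2  = 59 ^ 2 * 46
residueConstant₁ 3  = 101 * 46 ^ 2
residueConstant₁ 4  = 101 * 59 * 46
residueConstant₁ 5  = 20 ^ 3 * 46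
residueConstant₁ 6  = 26 * 20 ^ 2 * 46
residueConstant₁ 7  = 26 ^ 2 * 20 * 46
residueConstant₁ 8  = 20 ^ 2 * 46 ^ 2
residueConstant₁ 9  = 26 * 20 * 46 ^ 2
residueConstant₁ 10 = 26 ^ 2 * 46 ^ 2
residueConstant₁ 11 = 20 * 46 ^ 3
residueConstant₁ 12 = 26 * 46 ^ 3
residueConstant₁ _  = 59 * 26 * 46 ^ 2

-- Each part comes with its value of N; the descending order lets `blocks` produce nonincreasing
-- lists.
parts₀ parts₁ : List (ℕ × ℕ)
parts₀ = (13 , 37) ∷ (10 , 16) ∷ (7 , 7) ∷ []
parts₁ = (17 , 101) ∷ (15 , 59) ∷ (14 , 46) ∷ (12 , 26) ∷ (11 , 20) ∷ []

module Envelope₀ = Envelope 7 7 residueConstant₀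
module Envelope₁ = Envelope 14 46 residueConstant₁

module Large₀ = Envelope₀.Large 7 6 6756 75 (toWitness {a? = 7 ^ 7 ≤? 6 ^ 7 * 7} tt)
  (toWitness {a? = allUpTo? (λ i → allUpTo? (λ n →
    7 ^ (75 + i) * 6756 * Envelope₀.W n <? 6 ^ (75 + i) * Envelope₀.W (75 + i + n)) 7) 7} tt)
module Large₁ = Envelope₁.Large 7 6 6756 75 (toWitness {a? = 7 ^ 14 ≤? 6 ^ 14 * 46} tt)
  (toWitness {a? = allUpTo? (λ i → allUpTo? (λ n →
    7 ^ (75 + i) * 6756 * Envelope₁.W n <? 6 ^ (75 + i) * Envelope₁.W (75 + i + n)) 14) 14} tt)

Checked : ℕ → ℕ³ → Set
Checked k (x , y , z) = Envelope₀.StepAt (map proj₁ parts₀) k x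
                      × Envelope₁.StepAt (map proj₁ parts₁) k y
                      × Envelope₁.StepAt (map proj₁ parts₁) k z

checked? : ∀ k t → Dec (Checked k t)
checked? k (x , y , z) = Envelope₀.stepAt? (map proj₁ parts₀) k x
                   ×-dec Envelope₁.stepAt? (map proj₁ parts₁) k y
                   ×-dec Envelope₁.stepAt? (map proj₁ parts₁) k z

-- In a row stored in descending order, the number of entries after t is the integer k to which t
-- belongs.
AllChecked : List ℕ³ → Set
AllChecked []       = ⊤
AllChecked (t ∷ ts) = Checked (length ts) t × AllChecked ts

allChecked? : ∀ ts → Dec (AllChecked ts)
allChecked? []       = yes tt
allChecked? (t ∷ ts) = checked? (length ts) t ×-dec allChecked? ts

allChecked-applyDownFrom : ∀ g L → AllChecked (applyDownFrom g L) → ∀ {k} → k <′ L → Checked k (g k)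
allChecked-applyDownFrom g (suc L) (p , ps) <′-base      = subst (λ k → Checked k (g L)) (length-applyDownFrom g L) p
allChecked-applyDownFrom g (suc L) (p , ps) (≤′-step lt) = allChecked-applyDownFrom g L ps lt

-- The row has 75 entries, for the sums 0 to 74, so that bounding the parts by 74 excludes no
-- partition.
rankRow-checked : AllChecked (proj₂ (rows 75 74))
rankRow-checked = toWitness {a? = allChecked? (proj₂ (rows 75 74))} tt

N-checked : ∀ {k} → k < 75 → Checked k (N (+ 0) 3 k , N (+ 1) 3 k , N (+ 2) 3 k)
N-checked {k} k<75 = subst (Checked k) (sym (N-rankCounts (s≤s⁻¹ k<75)))
  (allChecked-applyDownFrom (rankCounts 74) 75
    (subst AllChecked (cong proj₂ (rows-correct 75 74)) rankRow-checked) (<⇒<′ k<75))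

-- The enumeration of partitions and maxima of lists

∈-partsFuel : ∀ {f n m μ} → n ≤ f → Linked _≥_ μ → All (1 ≤_) μ → sum μ ≡ n → largest μ ≤ m → μ ∈ partsFuel f n m
∈-partsFuel {n = zero}  {μ = []}        _ _ _ _ _ = here refl
∈-partsFuel {n = zero}  {μ = zero ∷ μ}  _ _ (() ∷ _) _ _
∈-partsFuel {suc f} {suc n} {m} {suc x ∷ μ} (s≤s n≤f) sorted (_ ∷ positive) refl x<m =
  ∈-concatMap⁺ _ (Any.map (λ { refl → ∈-map⁺ (suc x ∷_) rest }) (∈-applyUpTo⁺ suc x<))
  where
  x< : x < m ⊓ suc (x + sum μ)
  x< = ⊓-glb x<m (s≤s (m≤m+n x (sum μ)))
  bounded : ∀ {y ν} → Linked _≥_ (y ∷ ν) → largest ν ≤ y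
  bounded [-]       = z≤n
  bounded (y≥ ∷ _)  = y≥
  rest : μ ∈ partsFuel f (x + sum μ ∸ x) (suc x)
  rest = ∈-partsFuel (≤-trans (m∸n≤m (x + sum μ) x) n≤f) (Linked.tail sorted) positive
           (sym (m+n∸m≡n x (sum μ))) (bounded sorted)

∈-partitions : ∀ {n μ} → IsPartition n μ → μ ∈ partitions n
∈-partitions {μ = μ} p = ∈-partsFuel ≤-refl nonincreasing positive sums (subst (largest μ ≤_) sums (largest≤sum μ))
  where
  open IsPartition p
  largest≤sum : ∀ μ → largest μ ≤ sum μ
  largest≤sum []      = z≤n
  largest≤sum (x ∷ μ) = m≤m+n x (sum μ)

-- The sum is all that the upper bound for the maximum asks of an enumerated list, because the
-- envelope inequality holds for arbitrary lists.
partsFuel-sum : ∀ f n m → All (λ μ → sum μ ≡ n) (partsFuel f n m)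
partsFuel-sum f       zero    m = refl ∷ []
partsFuel-sum zero    (suc n) m = []
partsFuel-sum (suc f) (suc n) m = All.concat⁺ (All.map⁺ (All.applyUpTo⁺₁ suc (m ⊓ suc n) (λ {i} i< →
  All.map⁺ (All.map (λ sum≡ → trans (cong (_+_ (suc i)) sum≡) (m+[n∸m]≡n (≤-trans i< (m⊓n≤n m (suc n)))))
    (partsFuel-sum f (n ∸ i) (suc i))))))

foldr-⊔-≤ : ∀ {b xs} → All (_≤ b) xs → foldr _⊔_ 0 xs ≤ b
foldr-⊔-≤ []       = z≤n
foldr-⊔-≤ (p ∷ ps) = ⊔-lub p (foldr-⊔-≤ ps)

∈⇒≤foldr-⊔ : ∀ {x xs} → x ∈ xs → x ≤ foldr _⊔_ 0 xs
∈⇒≤foldr-⊔ {x} {_ ∷ xs} (here refl) = m≤m⊔n x _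
∈⇒≤foldr-⊔ {x} {y ∷ xs} (there x∈)  = ≤-trans (∈⇒≤foldr-⊔ x∈) (m≤n⊔m y _)

-- Partitions given by multiplicities

Exponents : List (ℕ × ℕ) → Set
Exponents ps = Vec ℕ (length ps)

total weight : ∀ ps → Exponents ps → ℕ
total []             []       = 0
total ((v , _) ∷ ps) (e ∷ es) = e * v + total ps es
weight []             []       = 1
weight ((_ , w) ∷ ps) (e ∷ es) = w ^ e * weight ps es

blocks : ∀ ps → Exponents ps → List ℕ
blocks []             []       = []
blocks ((v , _) ∷ ps) (e ∷ es) = replicate e v ++ blocks ps es

total-+ : ∀ ps us ws → total ps (zipWith _+_ us ws) ≡ total ps us + total ps ws
total-+ []             []       []       = refl
total-+ ((v , _) ∷ ps) (u ∷ us) (w ∷ ws) =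
  trans (cong (_+_ ((u + w) * v)) (total-+ ps us ws)) (rearrange u w v (total ps us) (total ps ws))
  where
  rearrange : ∀ u w v s t → (u + w) * v + (s + t) ≡ u * v + s + (w * v + t)
  rearrange = solve-∀

weight-+ : ∀ ps us ws → weight ps (zipWith _+_ us ws) ≡ weight ps us * weight ps ws
weight-+ []             []       []       = refl
weight-+ ((_ , x) ∷ ps) (u ∷ us) (w ∷ ws) =
  trans (cong₂ _*_ (^-distribˡ-+-* x u w) (weight-+ ps us ws))
        ([m*n]*[o*p]≡[m*o]*[n*p] (x ^ u) (x ^ w) (weight ps us) (weight ps ws))

sum-replicate : ∀ e v → sum (replicate e v) ≡ e * v
sum-replicate zero    v = refl
sum-replicate (suc e) v = cong (_+_ v) (sum-replicate e v)

sum-blocks : ∀ ps es → sum (blocks ps es) ≡ total ps es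
sum-blocks []             []       = refl
sum-blocks ((v , _) ∷ ps) (e ∷ es) = trans (sum-++ (replicate e v) (blocks ps es))
  (cong₂ _+_ (sum-replicate e v) (sum-blocks ps es))

module _ (f : ℕ → ℕ) where

  product-replicate : ∀ e v → product (map f (replicate e v)) ≡ f v ^ e
  product-replicate zero    v = refl
  product-replicate (suc e) v = cong (f v *_) (product-replicate e v)

  product-blocks : ∀ {ps} → All (λ (v , w) → f v ≡ w) ps → ∀ es → product (map f (blocks ps es)) ≡ weight ps es
  product-blocks {[]}           []           []       = refl
  product-blocks {(v , _) ∷ ps} (refl ∷ fps) (e ∷ es) = begin
    product (map f (replicate e v ++ blocks ps es))
      ≡⟨ cong product (map-++ f (replicate e v) (blocks ps es)) ⟩
    product (map f (replicate e v) ++ map f (blocks ps es))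
      ≡⟨ product-++ (map f (replicate e v)) (map f (blocks ps es)) ⟩
    product (map f (replicate e v)) * product (map f (blocks ps es))
      ≡⟨ cong₂ _*_ (product-replicate e v) (product-blocks fps es) ⟩
    f v ^ e * weight ps es ∎
    where open ≡-Reasoning

blocks-All : ∀ {P : ℕ → Set} ps es → All P (map proj₁ ps) → All P (blocks ps es)
blocks-All []       []       []       = []
blocks-All (_ ∷ ps) (e ∷ es) (p ∷ pᵥ) = All.++⁺ (All.replicate⁺ e p) (blocks-All ps es pᵥ)

blocks-sorted : ∀ ps es → AllPairs _>_ (map proj₁ ps) → AllPairs _≥_ (blocks ps es)
blocks-sorted []             []       []       = []
blocks-sorted ((v , _) ∷ ps) (e ∷ es) (v> ∷ desc) = AllPairs.++⁺ (constant e) (blocks-sorted ps es desc)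
  (All.replicate⁺ e (blocks-All ps es (All.map <⇒≤ v>)))
  where
  constant : ∀ e → AllPairs _≥_ (replicate e v)
  constant zero    = []
  constant (suc e) = All.replicate⁺ e ≤-refl ∷ constant e

sorted⇒blocks : ∀ ps μ → AllPairs _>_ (map proj₁ ps) → AllPairs _≥_ μ → All (_∈ map proj₁ ps) μ →
  ∃ λ es → μ ≡ blocks ps es
sorted⇒blocks []             []      _ _ _ = [] , refl
sorted⇒blocks []             (_ ∷ _) _ _ (() ∷ _)
sorted⇒blocks (p ∷ ps)       []      (_ ∷ desc) [] [] with sorted⇒blocks ps [] desc [] []
... | es , eq = 0 ∷ es , eq
sorted⇒blocks ((v , w) ∷ ps) (x ∷ μ) (v> ∷ desc) (x≥ ∷ sorted) (here refl ∷ μ∈)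
  with sorted⇒blocks ((v , w) ∷ ps) μ (v> ∷ desc) sorted μ∈
... | e ∷ es , eq = suc e ∷ es , cong (v ∷_) eq
sorted⇒blocks ((v , w) ∷ ps) (x ∷ μ) (v> ∷ desc) (x≥ ∷ sorted) (there x∈ ∷ μ∈)
  with sorted⇒blocks ps (x ∷ μ) desc (x≥ ∷ sorted) (x∈ ∷ All.zipWith (λ (y≤x , y∈) → later y≤x y∈) (x≥ , μ∈))
  where
  -- A head x other than v is smaller than v, and so is every later entry; hence v has multiplicity
  -- 0.
  later : ∀ {y} → y ≤ x → y ∈ v ∷ map proj₁ ps → y ∈ map proj₁ ps
  later v≤x (here refl) = ⊥-elim (<⇒≱ (All.lookup v> x∈) v≤x)
  later _   (there y∈)  = y∈
... | es , eq = 0 ∷ es , eq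

-- Equality in the envelope bound

module Extremal
  (f W : ℕ → ℕ) (ps : List (ℕ × ℕ))
  (f-values   : All (λ (v , w) → f v ≡ w) ps)
  (positive   : All (λ (v , w) → 1 ≤ v × 1 ≤ w) ps)
  (descending : AllPairs _>_ (map proj₁ ps))
  (step       : ∀ k n → f k * W n ≤ W (k + n))
  (strict     : ∀ {k} → 1 ≤ k → k ∉ map proj₁ ps → ∀ n → f k * W n < W (k + n))
  .{{_ : NonZero (W 0)}}
  where

  -- A record, so that the equation is not unfolded when instances of Tight are compared.
  record Tight (es : Exponents ps) : Set where
    constructor tight
    field equation : weight ps es * W 0 ≡ W (total ps es)
  open Tight

  bound : ∀ μ → product (map f μ) * W 0 ≤ W (sum μ)
  bound []      = ≤-reflexive (*-identityˡ (W 0))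
  bound (x ∷ μ) = begin
    f x * product (map f μ) * W 0   ≡⟨ *-assoc (f x) _ _ ⟩
    f x * (product (map f μ) * W 0) ≤⟨ *-monoʳ-≤ (f x) (bound μ) ⟩
    f x * W (sum μ)                 ≤⟨ step x (sum μ) ⟩
    W (x + sum μ)                   ∎
    where open ≤-Reasoning

  weight-bound : ∀ es → weight ps es * W 0 ≤ W (total ps es)
  weight-bound es = subst₂ (λ p s → p * W 0 ≤ W s) (product-blocks f f-values es) (sum-blocks ps es)
    (bound (blocks ps es))

  weight-positive : ∀ {ps} → All (λ (v , w) → 1 ≤ v × 1 ≤ w) ps → ∀ es → NonZero (weight ps es)
  weight-positive {[]}           []              []       = _
  weight-positive {(v , w) ∷ ps} ((_ , 1≤w) ∷ pos) (e ∷ es) =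
    m*n≢0 _ _ {{m^n≢0 w e {{>-nonZero 1≤w}}}} {{weight-positive pos es}}

  -- Replacing `us` by `us′` keeps the total and raises the weight, so a tight vector would yield
  -- one beyond the envelope, against `weight-bound`. No knowledge of the maximum is involved.
  exchange : ∀ us us′ {_ : True (weight ps us <? weight ps us′)} → total ps us ≡ total ps us′ →
    ∀ ws → ¬ Tight (zipWith _+_ us ws)
  exchange us us′ {lighter} total≡ ws t = <-irrefl (equation t) (begin-strict
    weight ps (zipWith _+_ us ws) * W 0    ≡⟨ cong (_* W 0) (weight-+ ps us ws) ⟩
    weight ps us * weight ps ws * W 0      <⟨ *-monoˡ-< (W 0) (*-monoˡ-< (weight ps ws) {{weight-positive positive ws}} (toWitness lighter)) ⟩
    weight ps us′ * weight ps ws * W 0     ≡⟨ cong (_* W 0) (weight-+ ps us′ ws) ⟨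
    weight ps (zipWith _+_ us′ ws) * W 0   ≤⟨ weight-bound (zipWith _+_ us′ ws) ⟩
    W (total ps (zipWith _+_ us′ ws))      ≡⟨ cong W (total-+ ps us′ ws) ⟩
    W (total ps us′ + total ps ws)         ≡⟨ cong (λ t → W (t + total ps ws)) total≡ ⟨
    W (total ps us + total ps ws)          ≡⟨ cong W (total-+ ps us ws) ⟨
    W (total ps (zipWith _+_ us ws))       ∎)
    where open ≤-Reasoning

  f-nonZero : ∀ {x} → x ∈ map proj₁ ps → NonZero (f x)
  f-nonZero = All.lookup (All.map⁺ (All.zipWith (λ { (refl , _ , 1≤w) → >-nonZero 1≤w }) (f-values , positive)))

  -- Equality for x ∷ μ forces equality in both inequalities that make up `bound`. The one from
  -- `step` rules out x outside the list, by `strict`; the other, after cancelling f x, is equality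
  -- for μ.
  tight-parts : ∀ μ → All (1 ≤_) μ → product (map f μ) * W 0 ≡ W (sum μ) → All (_∈ map proj₁ ps) μ
  tight-parts []      []         _     = []
  tight-parts (x ∷ μ) (1≤x ∷ 1≤) eq = x∈ ∷ tight-parts μ 1≤
    (*-cancelˡ-≡ _ _ (f x) {{f-nonZero x∈}} (≤-antisym (*-monoʳ-≤ (f x) (bound μ))
      (≤-trans (step x (sum μ)) (≤-reflexive (sym eq′)))))
    where
    eq′ : f x * (product (map f μ) * W 0) ≡ W (x + sum μ)
    eq′ = trans (sym (*-assoc (f x) _ _)) eq
    x∈ : x ∈ map proj₁ ps
    x∈ with x ∈? map proj₁ ps
    ... | yes x∈ = x∈
    ... | no  x∉ = ⊥-elim (<-irrefl eq′
      (≤-<-trans (*-monoʳ-≤ (f x) (bound μ)) (strict 1≤x x∉ (sum μ))))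

  -- For f = N(r, 3; ·) this is `maxN3` by unfolding.
  maximum : ℕ → ℕ
  maximum n = foldr _⊔_ 0 (map (product ∘ map f) (partitions n))

  module _
    (Canonical : Exponents ps → Set) (value : ℕ → ℕ) (maximiser : ℕ → List ℕ)
    (canonical⇒tight : ∀ {es} → Canonical es → Tight es)
    (tight⇒canonical : ∀ es → Tight es → Canonical es)
    (value-correct : ∀ {es} → Canonical es → value (total ps es) ≡ weight ps es)
    (maximiser-correct : ∀ {es} → Canonical es → maximiser (total ps es) ≡ blocks ps es)
    where

    blocks-isPartition : ∀ es → IsPartition (total ps es) (blocks ps es)
    blocks-isPartition es = record
      { nonincreasing = AllPairs⇒Linked (blocks-sorted ps es descending)
      ; positive      = blocks-All ps es (All.map⁺ (All.map proj₁ positive))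
      ; sums          = sum-blocks ps es
      }

    canonical-maximum : ∀ {es} → Canonical es → maximum (total ps es) ≡ weight ps es
    canonical-maximum {es} c = ≤-antisym
      (foldr-⊔-≤ (All.map⁺ (All.map (λ {μ} sum≡ → *-cancelʳ-≤ _ _ (W 0) (begin
        product (map f μ) * W 0 ≤⟨ bound μ ⟩
        W (sum μ)               ≡⟨ cong W sum≡ ⟩
        W (total ps es)         ≡⟨ equation (canonical⇒tight c) ⟨
        weight ps es * W 0      ∎)) (partsFuel-sum _ (total ps es) _))))
      (≤-trans (≤-reflexive (sym (product-blocks f f-values es)))
        (∈⇒≤foldr-⊔ (∈-map⁺ (product ∘ map f) (∈-partitions (blocks-isPartition es)))))
      where open ≤-Reasoning

    -- A canonical vector shows that the envelope is attained at n, so every maximising partition is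
    -- tight and therefore canonical too. The two vectors are never compared directly:
    -- `maximiser-correct` recovers either partition from the common total.
    extremal : ∀ {n} → (∃ λ es → Canonical es × total ps es ≡ n) →
      maximum n ≡ value n × (∀ μ → IsPartition n μ → (product (map f μ) ≡ maximum n ⇔ μ ≡ maximiser n))
    extremal (es , c , refl) = trans (canonical-maximum c) (sym (value-correct c)) ,
      λ μ p → mk⇔ (unique μ p) (attained μ)
      where
      attained : ∀ μ → μ ≡ maximiser (total ps es) → product (map f μ) ≡ maximum (total ps es)
      attained μ μ≡ = begin
        product (map f μ)                             ≡⟨ cong (product ∘ map f) (trans μ≡ (maximiser-correct c)) ⟩
        product (map f (blocks ps es))                ≡⟨ product-blocks f f-values es ⟩
        weight ps es                                  ≡⟨ canonical-maximum c ⟨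
        maximum (total ps es)                         ∎
        where open ≡-Reasoning
      unique : ∀ μ → IsPartition (total ps es) μ → product (map f μ) ≡ maximum (total ps es) →
        μ ≡ maximiser (total ps es)
      unique μ p max with
        sorted⇒blocks ps μ descending (Linked⇒AllPairs (λ x≥y y≥z → ≤-trans y≥z x≥y) (IsPartition.nonincreasing p))
          (tight-parts μ (IsPartition.positive p) (begin
            product (map f μ) * W 0 ≡⟨ cong (_* W 0) (trans max (canonical-maximum c)) ⟩
            weight ps es * W 0      ≡⟨ equation (canonical⇒tight c) ⟩
            W (total ps es)         ≡⟨ cong W (IsPartition.sums p) ⟨
            W (sum μ)               ∎))
        where open ≡-Reasoning
      ... | es′ , refl = sym (trans (cong maximiser (sym total≡)) (maximiser-correct c′))
        where
        total≡ : total ps es′ ≡ total ps es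
        total≡ = trans (sym (sum-blocks ps es′)) (IsPartition.sums p)
        c′ : Canonical es′
        c′ = tight⇒canonical es′ (tight (begin
          weight ps es′ * W 0 ≡⟨ cong (_* W 0) (trans (sym (product-blocks f f-values es′)) (trans max (canonical-maximum c))) ⟩
          weight ps es * W 0  ≡⟨ equation (canonical⇒tight c) ⟩
          W (total ps es)     ≡⟨ cong W total≡ ⟨
          W (total ps es′)    ∎))
          where open ≡-Reasoning

-- The rank counts as instances

N-bound : ∀ r {k} → 75 ≤ k → N (+ r) 3 k * 6 ^ k ≤ 7 ^ k * 6756
N-bound r {k} 75≤k = ≤-trans
  (*-monoˡ-≤ (6 ^ k) (length-filter (λ μ → (rank μ %ℕ 3) ≟ (+ r) %ℕ 3) (partitions k)))
  (partitions-bound (≤-trans (toWitness {a? = 30 ≤? 75} tt) 75≤k))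

checked₁ : ∀ {r} → r ≡ 1 ⊎ r ≡ 2 → ∀ {k} → k < 75 → Envelope₁.StepAt (map proj₁ parts₁) k (N (+ r) 3 k)
checked₁ (inj₁ refl) k<75 = proj₁ (proj₂ (N-checked k<75))
checked₁ (inj₂ refl) k<75 = proj₂ (proj₂ (N-checked k<75))

module Steps₀ = Large₀.Steps (map proj₁ parts₀) (N (+ 0) 3) (λ k<75 → proj₁ (N-checked k<75)) (N-bound 0)
module Steps₁ {r} (r≡ : r ≡ 1 ⊎ r ≡ 2) = Large₁.Steps (map proj₁ parts₁) (N (+ r) 3) (checked₁ r≡) (N-bound r)

positive? : ∀ ps → Dec (All (λ (v , w) → 1 ≤ v × 1 ≤ w) ps)
positive? = All.all? (λ p → (1 ≤? proj₁ p) ×-dec (1 ≤? proj₂ p))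

descending? : ∀ xs → Dec (AllPairs _>_ xs)
descending? = allPairs? _>?_

N-parts₀ : All (λ (v , w) → N (+ 0) 3 v ≡ w) parts₀
N-parts₀ = refl ∷ refl ∷ refl ∷ []

N-parts₁ : ∀ {r} → r ≡ 1 ⊎ r ≡ 2 → All (λ (v , w) → N (+ r) 3 v ≡ w) parts₁
N-parts₁ (inj₁ refl) = refl ∷ refl ∷ refl ∷ refl ∷ refl ∷ []
N-parts₁ (inj₂ refl) = refl ∷ refl ∷ refl ∷ refl ∷ refl ∷ []

module Extremal₀ = Extremal (N (+ 0) 3) Envelope₀.W parts₀ N-parts₀
  (toWitness {a? = positive? parts₀} tt) (toWitness {a? = descending? (map proj₁ parts₀)} tt) Steps₀.step Steps₀.strict
module Extremal₁ {r} (r≡ : r ≡ 1 ⊎ r ≡ 2) = Extremal (N (+ r) 3) Envelope₁.W parts₁ (N-parts₁ r≡)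
  (toWitness {a? = positive? parts₁} tt) (toWitness {a? = descending? (map proj₁ parts₁)} tt) (Steps₁.step r≡) (Steps₁.strict r≡)

-- Canonical multiplicities and exchanges

-- One shape for each residue modulo 7, in the order of `value0`; the number c of parts 7 is free.
data Canonical₀ : Exponents parts₀ → Set where
  []      : ∀ {c} → Canonical₀ (0 ∷ 0 ∷ c ∷ [])
  13²10   : ∀ {c} → Canonical₀ (2 ∷ 1 ∷ c ∷ [])
  13·10   : ∀ {c} → Canonical₀ (1 ∷ 1 ∷ c ∷ [])
  10¹     : ∀ {c} → Canonical₀ (0 ∷ 1 ∷ c ∷ [])
  13³     : ∀ {c} → Canonical₀ (3 ∷ 0 ∷ c ∷ [])
  13²     : ∀ {c} → Canonical₀ (2 ∷ 0 ∷ c ∷ [])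
  13¹     : ∀ {c} → Canonical₀ (1 ∷ 0 ∷ c ∷ [])

data Canonical₁ : Exponents parts₁ → Set where
  []      : ∀ {c} → Canonical₁ (0 ∷ 0 ∷ c ∷ 0 ∷ 0 ∷ [])
  15¹     : ∀ {c} → Canonical₁ (0 ∷ 1 ∷ c ∷ 0 ∷ 0 ∷ [])
  15²     : ∀ {c} → Canonical₁ (0 ∷ 2 ∷ c ∷ 0 ∷ 0 ∷ [])
  17¹     : ∀ {c} → Canonical₁ (1 ∷ 0 ∷ c ∷ 0 ∷ 0 ∷ [])
  17·15   : ∀ {c} → Canonical₁ (1 ∷ 1 ∷ c ∷ 0 ∷ 0 ∷ [])
  11³     : ∀ {c} → Canonical₁ (0 ∷ 0 ∷ c ∷ 0 ∷ 3 ∷ [])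
  12·11²  : ∀ {c} → Canonical₁ (0 ∷ 0 ∷ c ∷ 1 ∷ 2 ∷ [])
  12²11   : ∀ {c} → Canonical₁ (0 ∷ 0 ∷ c ∷ 2 ∷ 1 ∷ [])
  11²     : ∀ {c} → Canonical₁ (0 ∷ 0 ∷ c ∷ 0 ∷ 2 ∷ [])
  12·11   : ∀ {c} → Canonical₁ (0 ∷ 0 ∷ c ∷ 1 ∷ 1 ∷ [])
  12²     : ∀ {c} → Canonical₁ (0 ∷ 0 ∷ c ∷ 2 ∷ 0 ∷ [])
  11¹     : ∀ {c} → Canonical₁ (0 ∷ 0 ∷ c ∷ 0 ∷ 1 ∷ [])
  12¹     : ∀ {c} → Canonical₁ (0 ∷ 0 ∷ c ∷ 1 ∷ 0 ∷ [])
  15·12   : ∀ {c} → Canonical₁ (0 ∷ 1 ∷ c ∷ 1 ∷ 0 ∷ [])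

-- Three narrow exchanges suffice: 10, 10 for 13, 7 (256 < 259); four 13s for 10 and six 7s (1874161
-- < 1882384); three 13s and a 10 for seven 7s (810448 < 823543).
tight⇒canonical₀ : ∀ es → Extremal₀.Tight es → Canonical₀ es
tight⇒canonical₀ (0 ∷ 0 ∷ c ∷ []) t = []
tight⇒canonical₀ (0 ∷ 1 ∷ c ∷ []) t = 10¹
tight⇒canonical₀ (1 ∷ 0 ∷ c ∷ []) t = 13¹
tight⇒canonical₀ (1 ∷ 1 ∷ c ∷ []) t = 13·10
tight⇒canonical₀ (2 ∷ 0 ∷ c ∷ []) t = 13²
tight⇒canonical₀ (2 ∷ 1 ∷ c ∷ []) t = 13²10
tight⇒canonical₀ (3 ∷ 0 ∷ c ∷ []) t = 13³
tight⇒canonical₀ (3 ∷ 1 ∷ c ∷ []) t = ⊥-elim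
  (Extremal₀.exchange (3 ∷ 1 ∷ 0 ∷ []) (0 ∷ 0 ∷ 7 ∷ []) refl (0 ∷ 0 ∷ c ∷ []) t)
tight⇒canonical₀ (a ∷ suc (suc b) ∷ c ∷ []) t = ⊥-elim
  (Extremal₀.exchange (0 ∷ 2 ∷ 0 ∷ []) (1 ∷ 0 ∷ 1 ∷ []) refl (a ∷ b ∷ c ∷ []) t)
tight⇒canonical₀ (suc (suc (suc (suc a))) ∷ b ∷ c ∷ []) t = ⊥-elim
  (Extremal₀.exchange (4 ∷ 0 ∷ 0 ∷ []) (0 ∷ 1 ∷ 6 ∷ []) refl (a ∷ b ∷ c ∷ []) t)

module _ {r} (r≡ : r ≡ 1 ⊎ r ≡ 2) where
  open Extremal₁ r≡ using (Tight; exchange)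

  -- Twelve exchanges leave one shape for each residue modulo 14. The closest trades four 11s for
  -- 15, 15, 14, with products 160000 < 160126.
  tight⇒canonical₁ : ∀ es → Tight es → Canonical₁ es
  tight⇒canonical₁ (suc (suc a) ∷ b ∷ c ∷ d ∷ e ∷ []) t = ⊥-elim
    (exchange (2 ∷ 0 ∷ 0 ∷ 0 ∷ 0 ∷ []) (0 ∷ 0 ∷ 0 ∷ 1 ∷ 2 ∷ []) refl (a ∷ b ∷ c ∷ d ∷ e ∷ []) t)
  tight⇒canonical₁ (1 ∷ b ∷ c ∷ suc d ∷ e ∷ []) t = ⊥-elim
    (exchange (1 ∷ 0 ∷ 0 ∷ 1 ∷ 0 ∷ []) (0 ∷ 1 ∷ 1 ∷ 0 ∷ 0 ∷ []) refl (0 ∷ b ∷ c ∷ d ∷ e ∷ []) t)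
  tight⇒canonical₁ (1 ∷ b ∷ c ∷ 0 ∷ suc e ∷ []) t = ⊥-elim
    (exchange (1 ∷ 0 ∷ 0 ∷ 0 ∷ 1 ∷ []) (0 ∷ 0 ∷ 2 ∷ 0 ∷ 0 ∷ []) refl (0 ∷ b ∷ c ∷ 0 ∷ e ∷ []) t)
  tight⇒canonical₁ (1 ∷ 0 ∷ c ∷ 0 ∷ 0 ∷ []) t = 17¹
  tight⇒canonical₁ (1 ∷ 1 ∷ c ∷ 0 ∷ 0 ∷ []) t = 17·15
  tight⇒canonical₁ (1 ∷ suc (suc b) ∷ c ∷ 0 ∷ 0 ∷ []) t = ⊥-elim
    (exchange (1 ∷ 2 ∷ 0 ∷ 0 ∷ 0 ∷ []) (0 ∷ 0 ∷ 1 ∷ 0 ∷ 3 ∷ []) refl (0 ∷ b ∷ c ∷ 0 ∷ 0 ∷ []) t)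
  tight⇒canonical₁ (0 ∷ suc b ∷ c ∷ d ∷ suc e ∷ []) t = ⊥-elim
    (exchange (0 ∷ 1 ∷ 0 ∷ 0 ∷ 1 ∷ []) (0 ∷ 0 ∷ 1 ∷ 1 ∷ 0 ∷ []) refl (0 ∷ b ∷ c ∷ d ∷ e ∷ []) t)
  tight⇒canonical₁ (0 ∷ suc (suc (suc b)) ∷ c ∷ d ∷ 0 ∷ []) t = ⊥-elim
    (exchange (0 ∷ 3 ∷ 0 ∷ 0 ∷ 0 ∷ []) (1 ∷ 0 ∷ 2 ∷ 0 ∷ 0 ∷ []) refl (0 ∷ b ∷ c ∷ d ∷ 0 ∷ []) t)
  tight⇒canonical₁ (0 ∷ 2 ∷ c ∷ 0 ∷ 0 ∷ []) t = 15²
  tight⇒canonical₁ (0 ∷ 2 ∷ c ∷ suc d ∷ 0 ∷ []) t = ⊥-elim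
    (exchange (0 ∷ 2 ∷ 0 ∷ 1 ∷ 0 ∷ []) (0 ∷ 0 ∷ 3 ∷ 0 ∷ 0 ∷ []) refl (0 ∷ 0 ∷ c ∷ d ∷ 0 ∷ []) t)
  tight⇒canonical₁ (0 ∷ 1 ∷ c ∷ 0 ∷ 0 ∷ []) t = 15¹
  tight⇒canonical₁ (0 ∷ 1 ∷ c ∷ 1 ∷ 0 ∷ []) t = 15·12
  tight⇒canonical₁ (0 ∷ 1 ∷ c ∷ suc (suc d) ∷ 0 ∷ []) t = ⊥-elim
    (exchange (0 ∷ 1 ∷ 0 ∷ 2 ∷ 0 ∷ []) (0 ∷ 0 ∷ 2 ∷ 0 ∷ 1 ∷ []) refl (0 ∷ 0 ∷ c ∷ d ∷ 0 ∷ []) t)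
  tight⇒canonical₁ (0 ∷ 0 ∷ c ∷ suc (suc (suc d)) ∷ e ∷ []) t = ⊥-elim
    (exchange (0 ∷ 0 ∷ 0 ∷ 3 ∷ 0 ∷ []) (0 ∷ 0 ∷ 1 ∷ 0 ∷ 2 ∷ []) refl (0 ∷ 0 ∷ c ∷ d ∷ e ∷ []) t)
  tight⇒canonical₁ (0 ∷ 0 ∷ c ∷ 2 ∷ 0 ∷ []) t = 12²
  tight⇒canonical₁ (0 ∷ 0 ∷ c ∷ 2 ∷ 1 ∷ []) t = 12²11
  tight⇒canonical₁ (0 ∷ 0 ∷ c ∷ 2 ∷ suc (suc e) ∷ []) t = ⊥-elim
    (exchange (0 ∷ 0 ∷ 0 ∷ 2 ∷ 2 ∷ []) (1 ∷ 1 ∷ 1 ∷ 0 ∷ 0 ∷ []) refl (0 ∷ 0 ∷ c ∷ 0 ∷ e ∷ []) t)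
  tight⇒canonical₁ (0 ∷ 0 ∷ c ∷ 1 ∷ 0 ∷ []) t = 12¹
  tight⇒canonical₁ (0 ∷ 0 ∷ c ∷ 1 ∷ 1 ∷ []) t = 12·11
  tight⇒canonical₁ (0 ∷ 0 ∷ c ∷ 1 ∷ 2 ∷ []) t = 12·11²
  tight⇒canonical₁ (0 ∷ 0 ∷ c ∷ 1 ∷ suc (suc (suc e)) ∷ []) t = ⊥-elim
    (exchange (0 ∷ 0 ∷ 0 ∷ 1 ∷ 3 ∷ []) (1 ∷ 0 ∷ 2 ∷ 0 ∷ 0 ∷ []) refl (0 ∷ 0 ∷ c ∷ 0 ∷ e ∷ []) t)
  tight⇒canonical₁ (0 ∷ 0 ∷ c ∷ 0 ∷ 0 ∷ []) t = []
  tight⇒canonical₁ (0 ∷ 0 ∷ c ∷ 0 ∷ 1 ∷ []) t = 11¹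
  tight⇒canonical₁ (0 ∷ 0 ∷ c ∷ 0 ∷ 2 ∷ []) t = 11²
  tight⇒canonical₁ (0 ∷ 0 ∷ c ∷ 0 ∷ 3 ∷ []) t = 11³
  tight⇒canonical₁ (0 ∷ 0 ∷ c ∷ 0 ∷ suc (suc (suc (suc e))) ∷ []) t = ⊥-elim
    (exchange (0 ∷ 0 ∷ 0 ∷ 0 ∷ 4 ∷ []) (0 ∷ 2 ∷ 1 ∷ 0 ∷ 0 ∷ []) refl (0 ∷ 0 ∷ c ∷ 0 ∷ e ∷ []) t)

-- Splitting off the parts 7 and 14

total-main₀ : ∀ a b c → total parts₀ (a ∷ b ∷ c ∷ []) ≡ total parts₀ (a ∷ b ∷ 0 ∷ []) + c * 7
total-main₀ a b c = rearrange (a * 13) (b * 10) (c * 7)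
  where
  rearrange : ∀ x y z → x + (y + (z + 0)) ≡ x + (y + 0) + z
  rearrange = solve-∀

weight-main₀ : ∀ a b c → weight parts₀ (a ∷ b ∷ c ∷ []) ≡ weight parts₀ (a ∷ b ∷ 0 ∷ []) * 7 ^ c
weight-main₀ a b c = rearrange (37 ^ a) (16 ^ b) (7 ^ c)
  where
  rearrange : ∀ x y z → x * (y * (z * 1)) ≡ x * (y * 1) * z
  rearrange = solve-∀

total-main₁ : ∀ a b c d e →
  total parts₁ (a ∷ b ∷ c ∷ d ∷ e ∷ []) ≡ total parts₁ (a ∷ b ∷ 0 ∷ d ∷ e ∷ []) + c * 14
total-main₁ a b c d e = rearrange (a * 17) (b * 15) (c * 14) (total ((12 , 26) ∷ (11 , 20) ∷ []) (d ∷ e ∷ []))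
  where
  rearrange : ∀ x y z t → x + (y + (z + t)) ≡ x + (y + t) + z
  rearrange = solve-∀

weight-main₁ : ∀ a b c d e →
  weight parts₁ (a ∷ b ∷ c ∷ d ∷ e ∷ []) ≡ weight parts₁ (a ∷ b ∷ 0 ∷ d ∷ e ∷ []) * 46 ^ c
weight-main₁ a b c d e = rearrange (101 ^ a) (59 ^ b) (46 ^ c) (weight ((12 , 26) ∷ (11 , 20) ∷ []) (d ∷ e ∷ []))
  where
  rearrange : ∀ x y z t → x * (y * (z * t)) ≡ x * (y * (1 * t)) * z
  rearrange = solve-∀

-- Each further 7 multiplies both sides of the tightness equation by 7, so every canonical shape
-- reduces to one numerical equality at c = 0.
tight-main₀ : ∀ a b c → weight parts₀ (a ∷ b ∷ 0 ∷ []) * Envelope₀.W 0 ≡ Envelope₀.W (total parts₀ (a ∷ b ∷ 0 ∷ [])) →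
  Extremal₀.Tight (a ∷ b ∷ c ∷ [])
tight-main₀ a b c eq = Extremal₀.tight (subst₂ (λ w t → w * Envelope₀.W 0 ≡ Envelope₀.W t)
  (sym (weight-main₀ a b c)) (sym (total-main₀ a b c))
    (Envelope₀.W-scale (weight parts₀ (a ∷ b ∷ 0 ∷ [])) (total parts₀ (a ∷ b ∷ 0 ∷ [])) c eq))

canonical⇒tight₀ : ∀ {es} → Canonical₀ es → Extremal₀.Tight es
canonical⇒tight₀ []    = tight-main₀ 0 0 _ refl
canonical⇒tight₀ 13²10 = tight-main₀ 2 1 _ refl
canonical⇒tight₀ 13·10 = tight-main₀ 1 1 _ refl
canonical⇒tight₀ 10¹   = tight-main₀ 0 1 _ refl
canonical⇒tight₀ 13³   = tight-main₀ 3 0 _ refl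
canonical⇒tight₀ 13²   = tight-main₀ 2 0 _ refl
canonical⇒tight₀ 13¹   = tight-main₀ 1 0 _ refl

module _ {r} (r≡ : r ≡ 1 ⊎ r ≡ 2) where
  open Extremal₁ r≡ using (Tight; tight)

  tight-main₁ : ∀ a b c d e → weight parts₁ (a ∷ b ∷ 0 ∷ d ∷ e ∷ []) * Envelope₁.W 0 ≡
    Envelope₁.W (total parts₁ (a ∷ b ∷ 0 ∷ d ∷ e ∷ [])) → Tight (a ∷ b ∷ c ∷ d ∷ e ∷ [])
  tight-main₁ a b c d e eq = tight (subst₂ (λ w t → w * Envelope₁.W 0 ≡ Envelope₁.W t)
    (sym (weight-main₁ a b c d e)) (sym (total-main₁ a b c d e))
    (Envelope₁.W-scale (weight parts₁ (a ∷ b ∷ 0 ∷ d ∷ e ∷ [])) (total parts₁ (a ∷ b ∷ 0 ∷ d ∷ e ∷ [])) c eq))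

  canonical⇒tight₁ : ∀ {es} → Canonical₁ es → Tight es
  canonical⇒tight₁ []     = tight-main₁ 0 0 _ 0 0 refl
  canonical⇒tight₁ 15¹    = tight-main₁ 0 1 _ 0 0 refl
  canonical⇒tight₁ 15²    = tight-main₁ 0 2 _ 0 0 refl
  canonical⇒tight₁ 17¹    = tight-main₁ 1 0 _ 0 0 refl
  canonical⇒tight₁ 17·15  = tight-main₁ 1 1 _ 0 0 refl
  canonical⇒tight₁ 11³    = tight-main₁ 0 0 _ 0 3 refl
  canonical⇒tight₁ 12·11² = tight-main₁ 0 0 _ 1 2 refl
  canonical⇒tight₁ 12²11  = tight-main₁ 0 0 _ 2 1 refl
  canonical⇒tight₁ 11²    = tight-main₁ 0 0 _ 0 2 refl
  canonical⇒tight₁ 12·11  = tight-main₁ 0 0 _ 1 1 refl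
  canonical⇒tight₁ 12²    = tight-main₁ 0 0 _ 2 0 refl
  canonical⇒tight₁ 11¹    = tight-main₁ 0 0 _ 0 1 refl
  canonical⇒tight₁ 12¹    = tight-main₁ 0 0 _ 1 0 refl
  canonical⇒tight₁ 15·12  = tight-main₁ 0 1 _ 1 0 refl

total-residue₀ : ∀ a b c → total parts₀ (a ∷ b ∷ c ∷ []) % 7 ≡ total parts₀ (a ∷ b ∷ 0 ∷ []) % 7
total-residue₀ a b c = trans (cong (_% 7) (total-main₀ a b c)) ([m+kn]%n≡m%n (total parts₀ (a ∷ b ∷ 0 ∷ [])) c 7)

-- Recovers the number of 7s from the total, in the form in which the exponents of `value0` are
-- written.
total-quotient₀ : ∀ a b c → c ≡ (total parts₀ (a ∷ b ∷ c ∷ []) ∸ total parts₀ (a ∷ b ∷ 0 ∷ [])) / 7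
total-quotient₀ a b c = sym (trans
  (cong (_/ 7) (trans (cong (_∸ s) (total-main₀ a b c)) (m+n∸m≡n s (c * 7))))
  (m*n/n≡m c 7))
  where s = total parts₀ (a ∷ b ∷ 0 ∷ [])

total-residue₁ : ∀ a b c d e →
  total parts₁ (a ∷ b ∷ c ∷ d ∷ e ∷ []) % 14 ≡ total parts₁ (a ∷ b ∷ 0 ∷ d ∷ e ∷ []) % 14
total-residue₁ a b c d e = trans (cong (_% 14) (total-main₁ a b c d e))
  ([m+kn]%n≡m%n (total parts₁ (a ∷ b ∷ 0 ∷ d ∷ e ∷ [])) c 14)

total-quotient₁ : ∀ a b c d e →
  c ≡ (total parts₁ (a ∷ b ∷ c ∷ d ∷ e ∷ []) ∸ total parts₁ (a ∷ b ∷ 0 ∷ d ∷ e ∷ [])) / 14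
total-quotient₁ a b c d e = sym (trans
  (cong (_/ 14) (trans (cong (_∸ s) (total-main₁ a b c d e)) (m+n∸m≡n s (c * 14))))
  (m*n/n≡m c 14))
  where s = total parts₁ (a ∷ b ∷ 0 ∷ d ∷ e ∷ [])

-- Evaluation of the closed formulas

-- The coefficient k and the quotient q are variables, since rewrite normalises the goal and would
-- turn a product with a large literal into a unary sum.
value0-0 : ∀ n {q} → n % 7 ≡ 0 → q ≡ n / 7 → value0 n ≡ 7 ^ q × maximiser0 n ≡ replicate q 7
value0-0 n p refl rewrite p = refl , refl

value0-1 : ∀ n {k q} → n % 7 ≡ 1 → k ≡ 37 ^ 2 * 16 → q ≡ (n ∸ 36) / 7 →
  value0 n ≡ k * 7 ^ q × maximiser0 n ≡ 13 ∷ 13 ∷ 10 ∷ replicate q 7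
value0-1 n p k≡ refl rewrite p = cong (_* 7 ^ ((n ∸ 36) / 7)) (sym k≡) , refl

value0-2 : ∀ n {k q} → n % 7 ≡ 2 → k ≡ 37 * 16 → q ≡ (n ∸ 23) / 7 →
  value0 n ≡ k * 7 ^ q × maximiser0 n ≡ 13 ∷ 10 ∷ replicate q 7
value0-2 n p k≡ refl rewrite p = cong (_* 7 ^ ((n ∸ 23) / 7)) (sym k≡) , refl

value0-3 : ∀ n {k q} → n % 7 ≡ 3 → k ≡ 16 → q ≡ (n ∸ 10) / 7 →
  value0 n ≡ k * 7 ^ q × maximiser0 n ≡ 10 ∷ replicate q 7
value0-3 n p k≡ refl rewrite p = cong (_* 7 ^ ((n ∸ 10) / 7)) (sym k≡) , refl

value0-4 : ∀ n {k q} → n % 7 ≡ 4 → k ≡ 37 ^ 3 → q ≡ (n ∸ 39) / 7 →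
  value0 n ≡ k * 7 ^ q × maximiser0 n ≡ 13 ∷ 13 ∷ 13 ∷ replicate q 7
value0-4 n p k≡ refl rewrite p = cong (_* 7 ^ ((n ∸ 39) / 7)) (sym k≡) , refl

value0-5 : ∀ n {k q} → n % 7 ≡ 5 → k ≡ 37 ^ 2 → q ≡ (n ∸ 26) / 7 →
  value0 n ≡ k * 7 ^ q × maximiser0 n ≡ 13 ∷ 13 ∷ replicate q 7
value0-5 n p k≡ refl rewrite p = cong (_* 7 ^ ((n ∸ 26) / 7)) (sym k≡) , refl

value0-6 : ∀ n {k q} → n % 7 ≡ 6 → k ≡ 37 → q ≡ (n ∸ 13) / 7 →
  value0 n ≡ k * 7 ^ q × maximiser0 n ≡ 13 ∷ replicate q 7
value0-6 n p k≡ refl rewrite p = cong (_* 7 ^ ((n ∸ 13) / 7)) (sym k≡) , refl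

value12-0 : ∀ n {q} → n % 14 ≡ 0 → q ≡ n / 14 → value12 n ≡ 46 ^ q × maximiser12 n ≡ replicate q 14 ++ []
-- The first rewrite selects the default clause of `maximiser12`; the `prefix12 n` appearing there
-- branches on `n % 14` once more.
value12-0 n p refl rewrite p | p = refl , refl

value12-1 : ∀ n {k q} → n % 14 ≡ 1 → k ≡ 59 → q ≡ (n ∸ 15) / 14 →
  value12 n ≡ k * 46 ^ q × maximiser12 n ≡ 15 ∷ replicate q 14
value12-1 n p k≡ refl rewrite p = cong (_* 46 ^ ((n ∸ 15) / 14)) (sym k≡) , refl

value12-2 : ∀ n {k q} → n % 14 ≡ 2 → k ≡ 59 ^ 2 → q ≡ (n ∸ 30) / 14 →
  value12 n ≡ k * 46 ^ q × maximiser12 n ≡ 15 ∷ 15 ∷ replicate q 14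
value12-2 n p k≡ refl rewrite p = cong (_* 46 ^ ((n ∸ 30) / 14)) (sym k≡) , refl

value12-3 : ∀ n {k q} → n % 14 ≡ 3 → k ≡ 101 → q ≡ (n ∸ 17) / 14 →
  value12 n ≡ k * 46 ^ q × maximiser12 n ≡ 17 ∷ replicate q 14
value12-3 n p k≡ refl rewrite p = cong (_* 46 ^ ((n ∸ 17) / 14)) (sym k≡) , refl

value12-4 : ∀ n {k q} → n % 14 ≡ 4 → k ≡ 101 * 59 → q ≡ (n ∸ 32) / 14 →
  value12 n ≡ k * 46 ^ q × maximiser12 n ≡ 17 ∷ 15 ∷ replicate q 14
value12-4 n p k≡ refl rewrite p = cong (_* 46 ^ ((n ∸ 32) / 14)) (sym k≡) , refl

value12-5 : ∀ n {k q} → n % 14 ≡ 5 → k ≡ 20 ^ 3 → q ≡ (n ∸ 33) / 14 →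
  value12 n ≡ k * 46 ^ q × maximiser12 n ≡ replicate q 14 ++ 11 ∷ 11 ∷ 11 ∷ []
-- The two equations are kept apart because the maximiser takes two rewrites, and the second would
-- normalise the literal product exposed by the first in the value.
value12-5 n {k} {q} p k≡ refl = value≡ , maximiser≡
  where
  value≡ : value12 n ≡ k * 46 ^ q
  value≡ rewrite p = cong (_* 46 ^ ((n ∸ 33) / 14)) (sym k≡)
  maximiser≡ : maximiser12 n ≡ replicate q 14 ++ 11 ∷ 11 ∷ 11 ∷ []
  maximiser≡ rewrite p | p = refl

value12-6 : ∀ n {k q} → n % 14 ≡ 6 → k ≡ 26 * 20 ^ 2 → q ≡ (n ∸ 34) / 14 →
  value12 n ≡ k * 46 ^ q × maximiser12 n ≡ replicate q 14 ++ 12 ∷ 11 ∷ 11 ∷ []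
value12-6 n {k} {q} p k≡ refl = value≡ , maximiser≡
  where
  value≡ : value12 n ≡ k * 46 ^ q
  value≡ rewrite p = cong (_* 46 ^ ((n ∸ 34) / 14)) (sym k≡)
  maximiser≡ : maximiser12 n ≡ replicate q 14 ++ 12 ∷ 11 ∷ 11 ∷ []
  maximiser≡ rewrite p | p = refl

value12-7 : ∀ n {k q} → n % 14 ≡ 7 → k ≡ 26 ^ 2 * 20 → q ≡ (n ∸ 35) / 14 →
  value12 n ≡ k * 46 ^ q × maximiser12 n ≡ replicate q 14 ++ 12 ∷ 12 ∷ 11 ∷ []
value12-7 n {k} {q} p k≡ refl = value≡ , maximiser≡
  where
  value≡ : value12 n ≡ k * 46 ^ q
  value≡ rewrite p = cong (_* 46 ^ ((n ∸ 35) / 14)) (sym k≡)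
  maximiser≡ : maximiser12 n ≡ replicate q 14 ++ 12 ∷ 12 ∷ 11 ∷ []
  maximiser≡ rewrite p | p = refl

value12-8 : ∀ n {k q} → n % 14 ≡ 8 → k ≡ 20 ^ 2 → q ≡ (n ∸ 22) / 14 →
  value12 n ≡ k * 46 ^ q × maximiser12 n ≡ replicate q 14 ++ 11 ∷ 11 ∷ []
value12-8 n {k} {q} p k≡ refl = value≡ , maximiser≡
  where
  value≡ : value12 n ≡ k * 46 ^ q
  value≡ rewrite p = cong (_* 46 ^ ((n ∸ 22) / 14)) (sym k≡)
  maximiser≡ : maximiser12 n ≡ replicate q 14 ++ 11 ∷ 11 ∷ []
  maximiser≡ rewrite p | p = refl

value12-9 : ∀ n {k q} → n % 14 ≡ 9 → k ≡ 26 * 20 → q ≡ (n ∸ 23) / 14 →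
  value12 n ≡ k * 46 ^ q × maximiser12 n ≡ replicate q 14 ++ 12 ∷ 11 ∷ []
value12-9 n {k} {q} p k≡ refl = value≡ , maximiser≡
  where
  value≡ : value12 n ≡ k * 46 ^ q
  value≡ rewrite p = cong (_* 46 ^ ((n ∸ 23) / 14)) (sym k≡)
  maximiser≡ : maximiser12 n ≡ replicate q 14 ++ 12 ∷ 11 ∷ []
  maximiser≡ rewrite p | p = refl

value12-10 : ∀ n {k q} → n % 14 ≡ 10 → k ≡ 26 ^ 2 → q ≡ (n ∸ 24) / 14 →
  value12 n ≡ k * 46 ^ q × maximiser12 n ≡ replicate q 14 ++ 12 ∷ 12 ∷ []
value12-10 n {k} {q} p k≡ refl = value≡ , maximiser≡
  where
  value≡ : value12 n ≡ k * 46 ^ q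
  value≡ rewrite p = cong (_* 46 ^ ((n ∸ 24) / 14)) (sym k≡)
  maximiser≡ : maximiser12 n ≡ replicate q 14 ++ 12 ∷ 12 ∷ []
  maximiser≡ rewrite p | p = refl

value12-11 : ∀ n {k q} → n % 14 ≡ 11 → k ≡ 20 → q ≡ (n ∸ 11) / 14 →
  value12 n ≡ k * 46 ^ q × maximiser12 n ≡ replicate q 14 ++ 11 ∷ []
value12-11 n {k} {q} p k≡ refl = value≡ , maximiser≡
  where
  value≡ : value12 n ≡ k * 46 ^ q
  value≡ rewrite p = cong (_* 46 ^ ((n ∸ 11) / 14)) (sym k≡)
  maximiser≡ : maximiser12 n ≡ replicate q 14 ++ 11 ∷ []
  maximiser≡ rewrite p | p = refl

value12-12 : ∀ n {k q} → n % 14 ≡ 12 → k ≡ 26 → q ≡ (n ∸ 12) / 14 →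
  value12 n ≡ k * 46 ^ q × maximiser12 n ≡ replicate q 14 ++ 12 ∷ []
value12-12 n {k} {q} p k≡ refl = value≡ , maximiser≡
  where
  value≡ : value12 n ≡ k * 46 ^ q
  value≡ rewrite p = cong (_* 46 ^ ((n ∸ 12) / 14)) (sym k≡)
  maximiser≡ : maximiser12 n ≡ replicate q 14 ++ 12 ∷ []
  maximiser≡ rewrite p | p = refl

value12-13 : ∀ n {k q} → n % 14 ≡ 13 → k ≡ 59 * 26 → q ≡ (n ∸ 27) / 14 →
  value12 n ≡ k * 46 ^ q × maximiser12 n ≡ 15 ∷ (replicate q 14 ++ 12 ∷ [])
value12-13 n p k≡ refl rewrite p = cong (_* 46 ^ ((n ∸ 27) / 14)) (sym k≡) , refl

evaluate₀ : ∀ {es} → Canonical₀ es →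
  value0 (total parts₀ es) ≡ weight parts₀ es × maximiser0 (total parts₀ es) ≡ blocks parts₀ es
evaluate₀ ([] {c}) = Product.map
  (λ eq → trans (trans eq (sym (*-identityˡ (7 ^ c)))) (sym (weight-main₀ 0 0 c)))
  (λ eq → trans eq (sym (++-identityʳ (replicate c 7))))
  (value0-0 (total parts₀ (0 ∷ 0 ∷ c ∷ [])) {c} (total-residue₀ 0 0 c) (total-quotient₀ 0 0 c))
evaluate₀ (13²10 {c}) = Product.map
  (λ eq → trans eq (sym (weight-main₀ 2 1 c)))
  (λ eq → trans eq (cong (λ xs → 13 ∷ 13 ∷ 10 ∷ xs) (sym (++-identityʳ (replicate c 7)))))
  (value0-1 (total parts₀ (2 ∷ 1 ∷ c ∷ [])) {weight parts₀ (2 ∷ 1 ∷ 0 ∷ [])} {c} (total-residue₀ 2 1 c) refl (total-quotient₀ 2 1 c))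
evaluate₀ (13·10 {c}) = Product.map
  (λ eq → trans eq (sym (weight-main₀ 1 1 c)))
  (λ eq → trans eq (cong (λ xs → 13 ∷ 10 ∷ xs) (sym (++-identityʳ (replicate c 7)))))
  (value0-2 (total parts₀ (1 ∷ 1 ∷ c ∷ [])) {weight parts₀ (1 ∷ 1 ∷ 0 ∷ [])} {c} (total-residue₀ 1 1 c) refl (total-quotient₀ 1 1 c))
evaluate₀ (10¹ {c}) = Product.map
  (λ eq → trans eq (sym (weight-main₀ 0 1 c)))
  (λ eq → trans eq (cong (λ xs → 10 ∷ xs) (sym (++-identityʳ (replicate c 7)))))
  (value0-3 (total parts₀ (0 ∷ 1 ∷ c ∷ [])) {weight parts₀ (0 ∷ 1 ∷ 0 ∷ [])} {c} (total-residue₀ 0 1 c) refl (total-quotient₀ 0 1 c))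
evaluate₀ (13³ {c}) = Product.map
  (λ eq → trans eq (sym (weight-main₀ 3 0 c)))
  (λ eq → trans eq (cong (λ xs → 13 ∷ 13 ∷ 13 ∷ xs) (sym (++-identityʳ (replicate c 7)))))
  (value0-4 (total parts₀ (3 ∷ 0 ∷ c ∷ [])) {weight parts₀ (3 ∷ 0 ∷ 0 ∷ [])} {c} (total-residue₀ 3 0 c) refl (total-quotient₀ 3 0 c))
evaluate₀ (13² {c}) = Product.map
  (λ eq → trans eq (sym (weight-main₀ 2 0 c)))
  (λ eq → trans eq (cong (λ xs → 13 ∷ 13 ∷ xs) (sym (++-identityʳ (replicate c 7)))))
  (value0-5 (total parts₀ (2 ∷ 0 ∷ c ∷ [])) {weight parts₀ (2 ∷ 0 ∷ 0 ∷ [])} {c} (total-residue₀ 2 0 c) refl (total-quotient₀ 2 0 c))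
evaluate₀ (13¹ {c}) = Product.map
  (λ eq → trans eq (sym (weight-main₀ 1 0 c)))
  (λ eq → trans eq (cong (λ xs → 13 ∷ xs) (sym (++-identityʳ (replicate c 7)))))
  (value0-6 (total parts₀ (1 ∷ 0 ∷ c ∷ [])) {weight parts₀ (1 ∷ 0 ∷ 0 ∷ [])} {c} (total-residue₀ 1 0 c) refl (total-quotient₀ 1 0 c))

evaluate₁ : ∀ {es} → Canonical₁ es →
  value12 (total parts₁ es) ≡ weight parts₁ es × maximiser12 (total parts₁ es) ≡ blocks parts₁ es
evaluate₁ ([] {c}) = Product.map
  (λ eq → trans (trans eq (sym (*-identityˡ (46 ^ c)))) (sym (weight-main₁ 0 0 c 0 0)))
  id
  (value12-0 (total parts₁ (0 ∷ 0 ∷ c ∷ 0 ∷ 0 ∷ [])) {c} (total-residue₁ 0 0 c 0 0) (total-quotient₁ 0 0 c 0 0))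
evaluate₁ (15¹ {c}) = Product.map
  (λ eq → trans eq (sym (weight-main₁ 0 1 c 0 0)))
  (λ eq → trans eq (cong (λ xs → 15 ∷ xs) (sym (++-identityʳ (replicate c 14)))))
  (value12-1 (total parts₁ (0 ∷ 1 ∷ c ∷ 0 ∷ 0 ∷ [])) {weight parts₁ (0 ∷ 1 ∷ 0 ∷ 0 ∷ 0 ∷ [])} {c} (total-residue₁ 0 1 c 0 0) refl (total-quotient₁ 0 1 c 0 0))
evaluate₁ (15² {c}) = Product.map
  (λ eq → trans eq (sym (weight-main₁ 0 2 c 0 0)))
  (λ eq → trans eq (cong (λ xs → 15 ∷ 15 ∷ xs) (sym (++-identityʳ (replicate c 14)))))
  (value12-2 (total parts₁ (0 ∷ 2 ∷ c ∷ 0 ∷ 0 ∷ [])) {weight parts₁ (0 ∷ 2 ∷ 0 ∷ 0 ∷ 0 ∷ [])} {c} (total-residue₁ 0 2 c 0 0) refl (total-quotient₁ 0 2 c 0 0))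
evaluate₁ (17¹ {c}) = Product.map
  (λ eq → trans eq (sym (weight-main₁ 1 0 c 0 0)))
  (λ eq → trans eq (cong (λ xs → 17 ∷ xs) (sym (++-identityʳ (replicate c 14)))))
  (value12-3 (total parts₁ (1 ∷ 0 ∷ c ∷ 0 ∷ 0 ∷ [])) {weight parts₁ (1 ∷ 0 ∷ 0 ∷ 0 ∷ 0 ∷ [])} {c} (total-residue₁ 1 0 c 0 0) refl (total-quotient₁ 1 0 c 0 0))
evaluate₁ (17·15 {c}) = Product.map
  (λ eq → trans eq (sym (weight-main₁ 1 1 c 0 0)))
  (λ eq → trans eq (cong (λ xs → 17 ∷ 15 ∷ xs) (sym (++-identityʳ (replicate c 14)))))
  (value12-4 (total parts₁ (1 ∷ 1 ∷ c ∷ 0 ∷ 0 ∷ [])) {weight parts₁ (1 ∷ 1 ∷ 0 ∷ 0 ∷ 0 ∷ [])} {c} (total-residue₁ 1 1 c 0 0) refl (total-quotient₁ 1 1 c 0 0))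
evaluate₁ (11³ {c}) = Product.map
  (λ eq → trans eq (sym (weight-main₁ 0 0 c 0 3)))
  id
  (value12-5 (total parts₁ (0 ∷ 0 ∷ c ∷ 0 ∷ 3 ∷ [])) {weight parts₁ (0 ∷ 0 ∷ 0 ∷ 0 ∷ 3 ∷ [])} {c} (total-residue₁ 0 0 c 0 3) refl (total-quotient₁ 0 0 c 0 3))
evaluate₁ (12·11² {c}) = Product.map
  (λ eq → trans eq (sym (weight-main₁ 0 0 c 1 2)))
  id
  (value12-6 (total parts₁ (0 ∷ 0 ∷ c ∷ 1 ∷ 2 ∷ [])) {weight parts₁ (0 ∷ 0 ∷ 0 ∷ 1 ∷ 2 ∷ [])} {c} (total-residue₁ 0 0 c 1 2) refl (total-quotient₁ 0 0 c 1 2))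
evaluate₁ (12²11 {c}) = Product.map
  (λ eq → trans eq (sym (weight-main₁ 0 0 c 2 1)))
  id
  (value12-7 (total parts₁ (0 ∷ 0 ∷ c ∷ 2 ∷ 1 ∷ [])) {weight parts₁ (0 ∷ 0 ∷ 0 ∷ 2 ∷ 1 ∷ [])} {c} (total-residue₁ 0 0 c 2 1) refl (total-quotient₁ 0 0 c 2 1))
evaluate₁ (11² {c}) = Product.map
  (λ eq → trans eq (sym (weight-main₁ 0 0 c 0 2)))
  id
  (value12-8 (total parts₁ (0 ∷ 0 ∷ c ∷ 0 ∷ 2 ∷ [])) {weight parts₁ (0 ∷ 0 ∷ 0 ∷ 0 ∷ 2 ∷ [])} {c} (total-residue₁ 0 0 c 0 2) refl (total-quotient₁ 0 0 c 0 2))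
evaluate₁ (12·11 {c}) = Product.map
  (λ eq → trans eq (sym (weight-main₁ 0 0 c 1 1)))
  id
  (value12-9 (total parts₁ (0 ∷ 0 ∷ c ∷ 1 ∷ 1 ∷ [])) {weight parts₁ (0 ∷ 0 ∷ 0 ∷ 1 ∷ 1 ∷ [])} {c} (total-residue₁ 0 0 c 1 1) refl (total-quotient₁ 0 0 c 1 1))
evaluate₁ (12² {c}) = Product.map
  (λ eq → trans eq (sym (weight-main₁ 0 0 c 2 0)))
  id
  (value12-10 (total parts₁ (0 ∷ 0 ∷ c ∷ 2 ∷ 0 ∷ [])) {weight parts₁ (0 ∷ 0 ∷ 0 ∷ 2 ∷ 0 ∷ [])} {c} (total-residue₁ 0 0 c 2 0) refl (total-quotient₁ 0 0 c 2 0))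
evaluate₁ (11¹ {c}) = Product.map
  (λ eq → trans eq (sym (weight-main₁ 0 0 c 0 1)))
  id
  (value12-11 (total parts₁ (0 ∷ 0 ∷ c ∷ 0 ∷ 1 ∷ [])) {weight parts₁ (0 ∷ 0 ∷ 0 ∷ 0 ∷ 1 ∷ [])} {c} (total-residue₁ 0 0 c 0 1) refl (total-quotient₁ 0 0 c 0 1))
evaluate₁ (12¹ {c}) = Product.map
  (λ eq → trans eq (sym (weight-main₁ 0 0 c 1 0)))
  id
  (value12-12 (total parts₁ (0 ∷ 0 ∷ c ∷ 1 ∷ 0 ∷ [])) {weight parts₁ (0 ∷ 0 ∷ 0 ∷ 1 ∷ 0 ∷ [])} {c} (total-residue₁ 0 0 c 1 0) refl (total-quotient₁ 0 0 c 1 0))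
evaluate₁ (15·12 {c}) = Product.map
  (λ eq → trans eq (sym (weight-main₁ 0 1 c 1 0)))
  id
  (value12-13 (total parts₁ (0 ∷ 1 ∷ c ∷ 1 ∷ 0 ∷ [])) {weight parts₁ (0 ∷ 1 ∷ 0 ∷ 1 ∷ 0 ∷ [])} {c} (total-residue₁ 0 1 c 1 0) refl (total-quotient₁ 0 1 c 1 0))

-- Every large n has a canonical shape

-- Origin of 33: the largest sum of parts other than 7 in a canonical shape is 39 = 13 + 13 + 13, so
-- its class is missed at 32, whereas 33 to 39 are all reached.
reach₀ : ∀ i j → i < 7 → ∃ λ es → Canonical₀ es × total parts₀ es ≡ 33 + i + j * 7
reach₀ 0 j _ = (2 ∷ 0 ∷ 1 + j ∷ []) , 13² , total-main₀ 2 0 (1 + j)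
reach₀ 1 j _ = (1 ∷ 0 ∷ 3 + j ∷ []) , 13¹ , total-main₀ 1 0 (3 + j)
reach₀ 2 j _ = (0 ∷ 0 ∷ 5 + j ∷ []) , [] , total-main₀ 0 0 (5 + j)
reach₀ 3 j _ = (2 ∷ 1 ∷ j ∷ []) , 13²10 , total-main₀ 2 1 j
reach₀ 4 j _ = (1 ∷ 1 ∷ 2 + j ∷ []) , 13·10 , total-main₀ 1 1 (2 + j)
reach₀ 5 j _ = (0 ∷ 1 ∷ 4 + j ∷ []) , 10¹ , total-main₀ 0 1 (4 + j)
reach₀ 6 j _ = (3 ∷ 0 ∷ j ∷ []) , 13³ , total-main₀ 3 0 j
reach₀ (suc (suc (suc (suc (suc (suc (suc i))))))) j i<7 = ⊥-elim (m+n≮m 7 i i<7)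

canonical₀-total : ∀ n → 33 ≤ n → ∃ λ es → Canonical₀ es × total parts₀ es ≡ n
canonical₀-total n 33≤n with reach₀ ((n ∸ 33) % 7) ((n ∸ 33) / 7) (m%n<n (n ∸ 33) 7)
... | es , c , total≡ = es , c , trans total≡ (begin
  33 + (n ∸ 33) % 7 + (n ∸ 33) / 7 * 7   ≡⟨ +-assoc 33 ((n ∸ 33) % 7) _ ⟩
  33 + ((n ∸ 33) % 7 + (n ∸ 33) / 7 * 7) ≡⟨ cong (λ m → 33 + m) (m≡m%n+[m/n]*n (n ∸ 33) 7) ⟨
  33 + (n ∸ 33)                          ≡⟨ m+[n∸m]≡n 33≤n ⟩
  n                                      ∎)
  where open ≡-Reasoning

-- Likewise for 22: the largest sum of parts other than 14 is 35 = 12 + 12 + 11, so 21 is missed and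
-- 22 to 35 are all reached.
reach₁ : ∀ i j → i < 14 → ∃ λ es → Canonical₁ es × total parts₁ es ≡ 22 + i + j * 14
reach₁ 0 j _ = (0 ∷ 0 ∷ j ∷ 0 ∷ 2 ∷ []) , 11² , total-main₁ 0 0 j 0 2
reach₁ 1 j _ = (0 ∷ 0 ∷ j ∷ 1 ∷ 1 ∷ []) , 12·11 , total-main₁ 0 0 j 1 1
reach₁ 2 j _ = (0 ∷ 0 ∷ j ∷ 2 ∷ 0 ∷ []) , 12² , total-main₁ 0 0 j 2 0
reach₁ 3 j _ = (0 ∷ 0 ∷ 1 + j ∷ 0 ∷ 1 ∷ []) , 11¹ , total-main₁ 0 0 (1 + j) 0 1
reach₁ 4 j _ = (0 ∷ 0 ∷ 1 + j ∷ 1 ∷ 0 ∷ []) , 12¹ , total-main₁ 0 0 (1 + j) 1 0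
reach₁ 5 j _ = (0 ∷ 1 ∷ j ∷ 1 ∷ 0 ∷ []) , 15·12 , total-main₁ 0 1 j 1 0
reach₁ 6 j _ = (0 ∷ 0 ∷ 2 + j ∷ 0 ∷ 0 ∷ []) , [] , total-main₁ 0 0 (2 + j) 0 0
reach₁ 7 j _ = (0 ∷ 1 ∷ 1 + j ∷ 0 ∷ 0 ∷ []) , 15¹ , total-main₁ 0 1 (1 + j) 0 0
reach₁ 8 j _ = (0 ∷ 2 ∷ j ∷ 0 ∷ 0 ∷ []) , 15² , total-main₁ 0 2 j 0 0
reach₁ 9 j _ = (1 ∷ 0 ∷ 1 + j ∷ 0 ∷ 0 ∷ []) , 17¹ , total-main₁ 1 0 (1 + j) 0 0
reach₁ 10 j _ = (1 ∷ 1 ∷ j ∷ 0 ∷ 0 ∷ []) , 17·15 , total-main₁ 1 1 j 0 0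
reach₁ 11 j _ = (0 ∷ 0 ∷ j ∷ 0 ∷ 3 ∷ []) , 11³ , total-main₁ 0 0 j 0 3
reach₁ 12 j _ = (0 ∷ 0 ∷ j ∷ 1 ∷ 2 ∷ []) , 12·11² , total-main₁ 0 0 j 1 2
reach₁ 13 j _ = (0 ∷ 0 ∷ j ∷ 2 ∷ 1 ∷ []) , 12²11 , total-main₁ 0 0 j 2 1
reach₁ (suc (suc (suc (suc (suc (suc (suc (suc (suc (suc (suc (suc (suc (suc i)))))))))))))) j i<14 = ⊥-elim (m+n≮m 14 i i<14)

canonical₁-total : ∀ n → 22 ≤ n → ∃ λ es → Canonical₁ es × total parts₁ es ≡ n
canonical₁-total n 22≤n with reach₁ ((n ∸ 22) % 14) ((n ∸ 22) / 14) (m%n<n (n ∸ 22) 14)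
... | es , c , total≡ = es , c , trans total≡ (begin
  22 + (n ∸ 22) % 14 + (n ∸ 22) / 14 * 14   ≡⟨ +-assoc 22 ((n ∸ 22) % 14) _ ⟩
  22 + ((n ∸ 22) % 14 + (n ∸ 22) / 14 * 14) ≡⟨ cong (λ m → 22 + m) (m≡m%n+[m/n]*n (n ∸ 22) 14) ⟨
  22 + (n ∸ 22)                             ≡⟨ m+[n∸m]≡n 22≤n ⟩
  n                                         ∎)
  where open ≡-Reasoning

extremal₁ : ∀ {r} → r ≡ 1 ⊎ r ≡ 2 → ∀ n → 22 ≤ n → maxN3 (+ r) n ≡ value12 n
  × ((μ : List ℕ) → IsPartition n μ → (N3 (+ r) μ ≡ maxN3 (+ r) n ⇔ μ ≡ maximiser12 n))
extremal₁ r≡ n 22≤n = Extremal₁.extremal r≡ Canonical₁ value12 maximiser12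
  (canonical⇒tight₁ r≡) (tight⇒canonical₁ r≡) (λ c → proj₁ (evaluate₁ c)) (λ c → proj₂ (evaluate₁ c))
  (canonical₁-total n 22≤n)

theorem1p2 : ((n : ℕ) → 33 ≤ n →
    (maxN3 (+ 0) n ≡ value0 n)
    × ((μ : List ℕ) → IsPartition n μ → (N3 (+ 0) μ ≡ maxN3 (+ 0) n ⇔ μ ≡ maximiser0 n)))
    × ((n : ℕ) → 22 ≤ n →
    (maxN3 (+ 1) n ≡ maxN3 (+ 2) n)
    × (maxN3 (+ 1) n ≡ value12 n)
    × ((μ : List ℕ) → IsPartition n μ → (N3 (+ 1) μ ≡ maxN3 (+ 1) n ⇔ μ ≡ maximiser12 n))
    × ((μ : List ℕ) → IsPartition n μ → (N3 (+ 2) μ ≡ maxN3 (+ 2) n ⇔ μ ≡ maximiser12 n)))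
theorem1p2 =
  (λ n 33≤n → Extremal₀.extremal Canonical₀ value0 maximiser0 canonical⇒tight₀ tight⇒canonical₀
     (λ c → proj₁ (evaluate₀ c)) (λ c → proj₂ (evaluate₀ c)) (canonical₀-total n 33≤n)) ,
  (λ n 22≤n →
     let max₁ , unique₁ = extremal₁ (inj₁ refl) n 22≤n
         max₂ , unique₂ = extremal₁ (inj₂ refl) n 22≤n
     in trans max₁ (sym max₂) , max₁ , unique₁ , unique₂)
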